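{- Let $G$ be a connected $m$-vertex, $d$-regular graph (with $m\ge 2$ finite), and let $u\in V(G)$. For positive integers $n$ and $t\in[n]$, let $B_t:=\{u\}^t\times V(G)^{n-t}\subseteq V(G^n)$. (i) If $y_G=d$, then for every positive integer $n$ and every $t\in[n]$, the set $B_t$ has the smallest edge-boundary among all $m^{n-t}$-element sets of vertices of $G^n$, i.e. $e_{G^n}(B_t,B_t^c)\le e_{G^n}(A,A^c)$ for every $A\subseteq V(G^n)$ with $|A|=m^{n-t}$. (ii) For large enough $n$, the condition $y_G=d$ is also necessary: if $y_G<d$, then there is $n_0$ such that for every $n\ge n_0$ there exist $t\in[n]$ and a set $A\subseteq V(G^n)$ with $|A|=m^{n-t}$ and $e_{G^n}(A,A^c)<e_{G^n}(B_t,B_t^c)$.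
   Context: $\log$ is the natural logarithm and $[m]$ denotes $\{1,\dots,m\}$. For a graph $G$ and $A\subseteq V(G)$, $A^c = V(G)\setminus A$ and $e_G(A,A^c)$ is the number of edges of $G$ with exactly one endpoint in $A$. For an $m$-vertex graph $G$ and $k\in[m]$, $i_k(G) := \min\{e_G(A,A^c)/|A| : A\subseteq V(G),\ |A|=k\}$. $G^n$ denotes the product graph $G\square\cdots\square G$ ($n$ copies): its vertex set is $V(G)^n$ and its edges are all pairs $\{u,v\}$ for which there is an index $j\in[n]$ such that $u_jv_j\in E(G)$ and $u_l=v_l$ for all $l\neq j$. Definition of $y_G$: for every $k\in[m-1]$, let $\ell_k$ be the line $y=i_k(G)\cdot(\log m-x)/(\log m-\log k)$, which passes through $(\log k,i_k(G))$ and $(\log m,0)$. Let $k^*\in[m-1]$ be the smallest index $k$ such that $\ell_k$ has the largest (least negative) slope among $\ell_1,\dots,\ell_{m-1}$. Then $y_G$ is the $y$-intercept of $\ell_{k^*}$, i.e. $y_G=i_{k^*}(G)\cdot\log m/(\log m-\log k^*)$. Graphs are simple. -}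

module Defs where

open import Level using (0ℓ)
open import Data.Empty using (⊥-elim)
open import Data.Fin using (Fin; toℕ)
import Data.Fin.Properties as Finₚ
open import Data.Integer as ℤ using (ℤ; +_)
import Data.Integer.Properties as ℤₚ
open import Data.List.Base
  using (List; []; _∷_; _++_; length; filter; map; foldr; cartesianProduct; cartesianProductWith)
open import Data.List.Membership.Propositional using (_∈_)
open import Data.List.Membership.Propositional.Properties using (∈-cartesianProductWith⁺)
import Data.List.Membership.DecPropositional as DecMembership
open import Data.List.Relation.Unary.Any using (here)
import Data.List.Relation.Unary.All as All
import Data.List.Relation.Unary.AllPairs as AllPairs
open import Data.List.Relation.Unary.Unique.Propositional using (Unique)
open import Data.List.Relation.Unary.Unique.Propositional.Properties using (cartesianProductWith⁺)
open import Data.Nat as ℕ using (ℕ; zero; suc; NonZero; s≤s; z≤n)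
import Data.Nat.Properties as ℕₚ
open import Data.Product using (∃-syntax; _×_; _,_)
open import Data.Rational as ℚ using (ℚ; 0ℚ; 1ℚ; ½; _⊓_)
import Data.Rational.Properties as ℚₚ
import Data.Rational.Unnormalised as ℚᵘ
import Data.Rational.Unnormalised.Properties as ℚᵘₚ
open import Data.Rational.Solver using (module +-*-Solver)
open import Data.Sum using (inj₁; inj₂)
open import Data.Vec using (Vec; []; _∷_; lookup)
import Data.Vec.Properties as Vecₚ
open import Relation.Binary.Construct.Closure.ReflexiveTransitive using (Star)
open import Relation.Binary.Definitions using (DecidableEquality; Symmetric; Irreflexive)
import Relation.Binary.Definitions as B
open import Relation.Binary.PropositionalEquality
  using (_≡_; _≢_; refl; sym; trans; cong; cong₂; subst; subst₂)
open import Relation.Nullary using (¬_; yes; no)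
open import Relation.Nullary.Decidable using (_×-dec_; _→-dec_; ¬?)
open import Relation.Unary using (Pred; Decidable)

------------------------------------------------------------------------
-- Rational lemmas used to build the reals

0<p+q : ∀ {p q} → 0ℚ ℚ.< p → 0ℚ ℚ.< q → 0ℚ ℚ.< p ℚ.+ q
0<p+q {p} {q} 0<p 0<q =
  ℚₚ.positive⁻¹ (p ℚ.+ q) {{ℚₚ.pos+pos⇒pos p {{ℚ.positive 0<p}} q {{ℚ.positive 0<q}}}}

0<p*q : ∀ {p q} → 0ℚ ℚ.< p → 0ℚ ℚ.< q → 0ℚ ℚ.< p ℚ.* q
0<p*q {p} {q} 0<p 0<q =
  ℚₚ.positive⁻¹ (p ℚ.* q) {{ℚₚ.pos*pos⇒pos p {{ℚ.positive 0<p}} q {{ℚ.positive 0<q}}}}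

0<½ : 0ℚ ℚ.< ½
0<½ = ℚₚ.positive⁻¹ ½

0<1 : 0ℚ ℚ.< 1ℚ
0<1 = ℚₚ.positive⁻¹ 1ℚ

ℚ-*-mono-≤ : ∀ {p q r s} → 0ℚ ℚ.≤ r → 0ℚ ℚ.≤ q → p ℚ.≤ q → r ℚ.≤ s → p ℚ.* r ℚ.≤ q ℚ.* s
ℚ-*-mono-≤ {p} {q} {r} {s} 0≤r 0≤q p≤q r≤s = ℚₚ.≤-trans
  (ℚₚ.*-monoʳ-≤-nonNeg r {{ℚ.nonNegative 0≤r}} p≤q)
  (ℚₚ.*-monoˡ-≤-nonNeg q {{ℚ.nonNegative 0≤q}} r≤s)

∣-∣-bound : ∀ {p q ε} → p ℚ.- q ℚ.< ε → q ℚ.- p ℚ.< ε → ℚ.∣ p ℚ.- q ∣ ℚ.< ε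
∣-∣-bound {p} {q} {ε} a b with ℚₚ.∣p∣≡p∨∣p∣≡-p (p ℚ.- q)
... | inj₁ e = subst (ℚ._< ε) (sym e) a
... | inj₂ e = subst (ℚ._< ε) (trans lem (sym e)) b
  where
  open +-*-Solver
  lem : q ℚ.- p ≡ ℚ.- (p ℚ.- q)
  lem = solve 2 (λ p q → q :- p := :- (p :- q)) refl p q

-- The convention recip 0 = 0 never matters: it is only used on sequences
-- that are eventually bounded away from 0.
recip : ℚ → ℚ
recip p with p ℚₚ.≟ 0ℚ
... | yes _  = 0ℚ
... | no p≢0 = (ℚ.1/ p) {{ℚ.≢-nonZero p≢0}}

recip-inverse : ∀ {p} → 0ℚ ℚ.< p → recip p ℚ.* p ≡ 1ℚ
recip-inverse {p} 0<p with p ℚₚ.≟ 0ℚ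
... | yes p≡0 = ⊥-elim (ℚₚ.<-irrefl (sym p≡0) 0<p)
... | no p≢0  = ℚₚ.*-inverseˡ p {{ℚ.≢-nonZero p≢0}}

recip-pos : ∀ {p} → 0ℚ ℚ.< p → 0ℚ ℚ.< recip p
recip-pos {p} 0<p with p ℚₚ.≟ 0ℚ
... | yes p≡0 = ⊥-elim (ℚₚ.<-irrefl (sym p≡0) 0<p)
... | no p≢0  = ℚₚ.positive⁻¹ _ {{ℚₚ.1/pos⇒pos p {{ℚ.positive 0<p}}}}

recip-anti : ∀ {ε p} → 0ℚ ℚ.< ε → ε ℚ.≤ p → recip p ℚ.≤ recip ε
recip-anti {ε} {p} 0<ε ε≤p = subst₂ ℚ._≤_ lhs rhs
  (ℚₚ.*-monoˡ-≤-nonNeg (recip p ℚ.* recip ε)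
    {{ℚ.nonNegative (ℚₚ.<⇒≤ (0<p*q (recip-pos 0<p) (recip-pos 0<ε)))}} ε≤p)
  where
  open +-*-Solver
  0<p = ℚₚ.<-≤-trans 0<ε ε≤p
  lhs : recip p ℚ.* recip ε ℚ.* ε ≡ recip p
  lhs = trans (ℚₚ.*-assoc (recip p) (recip ε) ε)
          (trans (cong (recip p ℚ.*_) (recip-inverse 0<ε)) (ℚₚ.*-identityʳ _))
  rhs : recip p ℚ.* recip ε ℚ.* p ≡ recip ε
  rhs = trans (solve 3 (λ r s p → r :* s :* p := s :* (r :* p)) refl (recip p) (recip ε) p)
          (trans (cong (recip ε ℚ.*_) (recip-inverse 0<p)) (ℚₚ.*-identityʳ _))

------------------------------------------------------------------------
-- Real numbers: Cauchy sequences of rationals up to ≃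

Cauchy : (ℕ → ℚ) → Set
Cauchy x = ∀ ε → 0ℚ ℚ.< ε →
  ∃[ N ] (∀ m n → N ℕ.≤ m → N ℕ.≤ n → ℚ.∣ x m ℚ.- x n ∣ ℚ.< ε)

record ℝ : Set where
  constructor mkℝ
  field
    seq    : ℕ → ℚ
    cauchy : Cauchy seq

open ℝ public

infix  4 _≃_ _<ℝ_ _≤ℝ_
infixl 6 _-ℝ_
infixl 7 _*ℝ_

_≃_ : ℝ → ℝ → Set
x ≃ y = ∀ ε → 0ℚ ℚ.< ε → ∃[ N ] (∀ n → N ℕ.≤ n → ℚ.∣ seq x n ℚ.- seq y n ∣ ℚ.< ε)

_<ℝ_ : ℝ → ℝ → Set
x <ℝ y = ∃[ ε ] 0ℚ ℚ.< ε × ∃[ N ] (∀ n → N ℕ.≤ n → seq x n ℚ.+ ε ℚ.≤ seq y n)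

_≤ℝ_ : ℝ → ℝ → Set
x ≤ℝ y = ¬ (y <ℝ x)

fromℚ : ℚ → ℝ
fromℚ p = mkℝ (λ _ → p) λ ε 0<ε → 0 , λ _ _ _ _ →
  subst (ℚ._< ε) (sym (cong ℚ.∣_∣ (ℚₚ.+-inverseʳ p))) 0<ε

fromℕ : ℕ → ℝ
fromℕ n = fromℚ (+ n ℚ./ 1)

0ℝ : ℝ
0ℝ = fromℕ 0

_-ℝ_ : ℝ → ℝ → ℝ
x -ℝ y = mkℝ (λ n → seq x n ℚ.- seq y n) λ ε 0<ε →
  let N₁ , p = cauchy x (½ ℚ.* ε) (0<p*q 0<½ 0<ε)
      N₂ , q = cauchy y (½ ℚ.* ε) (0<p*q 0<½ 0<ε)
  in N₁ ℕ.⊔ N₂ , λ m n m≥ n≥ → bound ε (seq x m) (seq x n) (seq y m) (seq y n)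
       (p m n (ℕₚ.≤-trans (ℕₚ.m≤m⊔n N₁ N₂) m≥) (ℕₚ.≤-trans (ℕₚ.m≤m⊔n N₁ N₂) n≥))
       (q m n (ℕₚ.≤-trans (ℕₚ.m≤n⊔m N₁ N₂) m≥) (ℕₚ.≤-trans (ℕₚ.m≤n⊔m N₁ N₂) n≥))
  where
  open +-*-Solver
  bound : ∀ ε a b c d → ℚ.∣ a ℚ.- b ∣ ℚ.< ½ ℚ.* ε → ℚ.∣ c ℚ.- d ∣ ℚ.< ½ ℚ.* ε →
          ℚ.∣ (a ℚ.- c) ℚ.- (b ℚ.- d) ∣ ℚ.< ε
  bound ε a b c d ab cd = begin-strict
    ℚ.∣ (a ℚ.- c) ℚ.- (b ℚ.- d) ∣
      ≡⟨ cong ℚ.∣_∣ (solve 4 (λ a b c d → (a :- c) :- (b :- d) := (a :- b) :- (c :- d)) refl a b c d) ⟩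
    ℚ.∣ (a ℚ.- b) ℚ.- (c ℚ.- d) ∣
      ≤⟨ ℚₚ.∣p-q∣≤∣p∣+∣q∣ (a ℚ.- b) (c ℚ.- d) ⟩
    ℚ.∣ a ℚ.- b ∣ ℚ.+ ℚ.∣ c ℚ.- d ∣
      <⟨ ℚₚ.+-mono-< ab cd ⟩
    ½ ℚ.* ε ℚ.+ ½ ℚ.* ε
      ≡⟨ solve 1 (λ e → con ½ :* e :+ con ½ :* e := e) refl ε ⟩
    ε ∎
    where open ℚₚ.≤-Reasoning

bounded : ∀ x → ∃[ C ] 0ℚ ℚ.< C × ∃[ N ] (∀ n → N ℕ.≤ n → ℚ.∣ seq x n ∣ ℚ.< C)
bounded x =
  let N , p = cauchy x 1ℚ 0<1
      xN = seq x N
  in 1ℚ ℚ.+ ℚ.∣ xN ∣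
   , ℚₚ.<-≤-trans 0<1 (subst (ℚ._≤ 1ℚ ℚ.+ ℚ.∣ xN ∣) (ℚₚ.+-identityʳ 1ℚ) (ℚₚ.+-monoʳ-≤ 1ℚ (ℚₚ.0≤∣p∣ xN)))
   , N , λ n n≥ → step (seq x n) xN (p n N n≥ ℕₚ.≤-refl)
  where
  open +-*-Solver
  step : ∀ a b → ℚ.∣ a ℚ.- b ∣ ℚ.< 1ℚ → ℚ.∣ a ∣ ℚ.< 1ℚ ℚ.+ ℚ.∣ b ∣
  step a b a-b = begin-strict
    ℚ.∣ a ∣                      ≡⟨ cong ℚ.∣_∣ (solve 2 (λ a b → a := (a :- b) :+ b) refl a b) ⟩
    ℚ.∣ (a ℚ.- b) ℚ.+ b ∣        ≤⟨ ℚₚ.∣p+q∣≤∣p∣+∣q∣ (a ℚ.- b) b ⟩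
    ℚ.∣ a ℚ.- b ∣ ℚ.+ ℚ.∣ b ∣    <⟨ ℚₚ.+-monoˡ-< ℚ.∣ b ∣ a-b ⟩
    1ℚ ℚ.+ ℚ.∣ b ∣               ∎
    where open ℚₚ.≤-Reasoning

_*ℝ_ : ℝ → ℝ → ℝ
x *ℝ y = mkℝ (λ n → seq x n ℚ.* seq y n) λ ε 0<ε →
  let C , 0<C , N₁ , p = bounded x
      D , 0<D , N₂ , q = bounded y
      0<C+D = 0<p+q 0<C 0<D
      δ = recip (C ℚ.+ D) ℚ.* ε
      0<δ = 0<p*q (recip-pos 0<C+D) 0<ε
      N₃ , r = cauchy x δ 0<δ
      N₄ , s = cauchy y δ 0<δ
      N = (N₁ ℕ.⊔ N₂) ℕ.⊔ (N₃ ℕ.⊔ N₄)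
      le₁ = ℕₚ.≤-trans (ℕₚ.m≤m⊔n N₁ N₂) (ℕₚ.m≤m⊔n (N₁ ℕ.⊔ N₂) (N₃ ℕ.⊔ N₄))
      le₂ = ℕₚ.≤-trans (ℕₚ.m≤n⊔m N₁ N₂) (ℕₚ.m≤m⊔n (N₁ ℕ.⊔ N₂) (N₃ ℕ.⊔ N₄))
      le₃ = ℕₚ.≤-trans (ℕₚ.m≤m⊔n N₃ N₄) (ℕₚ.m≤n⊔m (N₁ ℕ.⊔ N₂) (N₃ ℕ.⊔ N₄))
      le₄ = ℕₚ.≤-trans (ℕₚ.m≤n⊔m N₃ N₄) (ℕₚ.m≤n⊔m (N₁ ℕ.⊔ N₂) (N₃ ℕ.⊔ N₄))
  in N , λ m n m≥ n≥ → bound ε C D 0<C 0<D (seq x m) (seq x n) (seq y m) (seq y n)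
       (p m (ℕₚ.≤-trans le₁ m≥)) (q n (ℕₚ.≤-trans le₂ n≥))
       (r m n (ℕₚ.≤-trans le₃ m≥) (ℕₚ.≤-trans le₃ n≥))
       (s m n (ℕₚ.≤-trans le₄ m≥) (ℕₚ.≤-trans le₄ n≥))
  where
  open +-*-Solver
  bound : ∀ ε C D → 0ℚ ℚ.< C → 0ℚ ℚ.< D → ∀ a b c d → ℚ.∣ a ∣ ℚ.< C → ℚ.∣ d ∣ ℚ.< D →
          ℚ.∣ a ℚ.- b ∣ ℚ.< recip (C ℚ.+ D) ℚ.* ε → ℚ.∣ c ℚ.- d ∣ ℚ.< recip (C ℚ.+ D) ℚ.* ε →
          ℚ.∣ a ℚ.* c ℚ.- b ℚ.* d ∣ ℚ.< ε
  bound ε C D 0<C 0<D a b c d a<C d<D ab cd = begin-strict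
    ℚ.∣ a ℚ.* c ℚ.- b ℚ.* d ∣
      ≡⟨ cong ℚ.∣_∣ (solve 4 (λ a b c d → a :* c :- b :* d := a :* (c :- d) :+ d :* (a :- b)) refl a b c d) ⟩
    ℚ.∣ a ℚ.* (c ℚ.- d) ℚ.+ d ℚ.* (a ℚ.- b) ∣
      ≤⟨ ℚₚ.∣p+q∣≤∣p∣+∣q∣ (a ℚ.* (c ℚ.- d)) (d ℚ.* (a ℚ.- b)) ⟩
    ℚ.∣ a ℚ.* (c ℚ.- d) ∣ ℚ.+ ℚ.∣ d ℚ.* (a ℚ.- b) ∣
      ≡⟨ cong₂ ℚ._+_ (ℚₚ.∣p*q∣≡∣p∣*∣q∣ a (c ℚ.- d)) (ℚₚ.∣p*q∣≡∣p∣*∣q∣ d (a ℚ.- b)) ⟩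
    ℚ.∣ a ∣ ℚ.* ℚ.∣ c ℚ.- d ∣ ℚ.+ ℚ.∣ d ∣ ℚ.* ℚ.∣ a ℚ.- b ∣
      ≤⟨ ℚₚ.+-mono-≤ (ℚₚ.*-monoʳ-≤-nonNeg ℚ.∣ c ℚ.- d ∣ {{ℚₚ.∣-∣-nonNeg (c ℚ.- d)}} (ℚₚ.<⇒≤ a<C))
                     (ℚₚ.*-monoʳ-≤-nonNeg ℚ.∣ a ℚ.- b ∣ {{ℚₚ.∣-∣-nonNeg (a ℚ.- b)}} (ℚₚ.<⇒≤ d<D)) ⟩
    C ℚ.* ℚ.∣ c ℚ.- d ∣ ℚ.+ D ℚ.* ℚ.∣ a ℚ.- b ∣
      <⟨ ℚₚ.+-mono-< (ℚₚ.*-monoʳ-<-pos C {{ℚ.positive 0<C}} cd)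
                     (ℚₚ.*-monoʳ-<-pos D {{ℚ.positive 0<D}} ab) ⟩
    C ℚ.* (recip (C ℚ.+ D) ℚ.* ε) ℚ.+ D ℚ.* (recip (C ℚ.+ D) ℚ.* ε)
      ≡⟨ solve 4 (λ C D r e → C :* (r :* e) :+ D :* (r :* e) := (r :* (C :+ D)) :* e) refl C D (recip (C ℚ.+ D)) ε ⟩
    (recip (C ℚ.+ D) ℚ.* (C ℚ.+ D)) ℚ.* ε
      ≡⟨ cong (ℚ._* ε) (recip-inverse (0<p+q 0<C 0<D)) ⟩
    1ℚ ℚ.* ε
      ≡⟨ ℚₚ.*-identityˡ ε ⟩
    ε ∎
    where open ℚₚ.≤-Reasoning

inverse : (x : ℝ) → 0ℝ <ℝ x → ℝ
inverse x (ε , 0<ε , N , x≥ε) = mkℝ (λ n → recip (seq x n)) λ η 0<η →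
  let N′ , p = cauchy x (η ℚ.* (ε ℚ.* ε)) (0<p*q 0<η (0<p*q 0<ε 0<ε))
  in N ℕ.⊔ N′ , λ m n m≥ n≥ →
       bound η (seq x m) (seq x n)
         (ge m (ℕₚ.≤-trans (ℕₚ.m≤m⊔n N N′) m≥)) (ge n (ℕₚ.≤-trans (ℕₚ.m≤m⊔n N N′) n≥))
         (p n m (ℕₚ.≤-trans (ℕₚ.m≤n⊔m N N′) n≥) (ℕₚ.≤-trans (ℕₚ.m≤n⊔m N N′) m≥))
  where
  open +-*-Solver
  ge : ∀ n → N ℕ.≤ n → ε ℚ.≤ seq x n
  ge n n≥ = subst (ℚ._≤ seq x n) (ℚₚ.+-identityˡ ε) (x≥ε n n≥)
  bound : ∀ η a b → ε ℚ.≤ a → ε ℚ.≤ b → ℚ.∣ b ℚ.- a ∣ ℚ.< η ℚ.* (ε ℚ.* ε) →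
          ℚ.∣ recip a ℚ.- recip b ∣ ℚ.< η
  bound η a b ε≤a ε≤b ba = begin-strict
    ℚ.∣ r ℚ.- s ∣
      ≡⟨ cong ℚ.∣_∣ (cong₂ ℚ._-_ (sym (trans (cong (r ℚ.*_) (recip-inverse 0<b)) (ℚₚ.*-identityʳ r)))
                                 (sym (trans (cong (s ℚ.*_) (recip-inverse 0<a)) (ℚₚ.*-identityʳ s)))) ⟩
    ℚ.∣ r ℚ.* (s ℚ.* b) ℚ.- s ℚ.* (r ℚ.* a) ∣
      ≡⟨ cong ℚ.∣_∣ (solve 4 (λ r s a b → r :* (s :* b) :- s :* (r :* a) := (r :* s) :* (b :- a)) refl r s a b) ⟩
    ℚ.∣ (r ℚ.* s) ℚ.* (b ℚ.- a) ∣
      ≡⟨ ℚₚ.∣p*q∣≡∣p∣*∣q∣ (r ℚ.* s) (b ℚ.- a) ⟩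
    ℚ.∣ r ℚ.* s ∣ ℚ.* ℚ.∣ b ℚ.- a ∣
      ≡⟨ cong (ℚ._* ℚ.∣ b ℚ.- a ∣) (ℚₚ.0≤p⇒∣p∣≡p (ℚₚ.<⇒≤ (0<p*q 0<r 0<s))) ⟩
    (r ℚ.* s) ℚ.* ℚ.∣ b ℚ.- a ∣
      ≤⟨ ℚₚ.*-monoʳ-≤-nonNeg ℚ.∣ b ℚ.- a ∣ {{ℚₚ.∣-∣-nonNeg (b ℚ.- a)}}
           (ℚ-*-mono-≤ (ℚₚ.<⇒≤ 0<s) (ℚₚ.<⇒≤ 0<R) (recip-anti 0<ε ε≤a) (recip-anti 0<ε ε≤b)) ⟩
    (R ℚ.* R) ℚ.* ℚ.∣ b ℚ.- a ∣
      <⟨ ℚₚ.*-monoʳ-<-pos (R ℚ.* R) {{ℚ.positive (0<p*q 0<R 0<R)}} ba ⟩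
    (R ℚ.* R) ℚ.* (η ℚ.* (ε ℚ.* ε))
      ≡⟨ solve 3 (λ R η ε → (R :* R) :* (η :* (ε :* ε)) := η :* ((R :* ε) :* (R :* ε))) refl R η ε ⟩
    η ℚ.* ((R ℚ.* ε) ℚ.* (R ℚ.* ε))
      ≡⟨ cong (λ z → η ℚ.* (z ℚ.* z)) (recip-inverse 0<ε) ⟩
    η ℚ.* (1ℚ ℚ.* 1ℚ)
      ≡⟨ ℚₚ.*-identityʳ η ⟩
    η ∎
    where
    open ℚₚ.≤-Reasoning
    r = recip a
    s = recip b
    R = recip ε
    0<a = ℚₚ.<-≤-trans 0<ε ε≤a
    0<b = ℚₚ.<-≤-trans 0<ε ε≤b
    0<r = recip-pos 0<a
    0<s = recip-pos 0<b
    0<R = recip-pos 0<ε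

------------------------------------------------------------------------
-- Natural logarithm of a positive integer

-- harmonic a l = 1/(a+1) + 1/(a+2) + ⋯ + 1/(a+l)
harmonic : ℕ → ℕ → ℚ
harmonic a zero    = 0ℚ
harmonic a (suc l) = + 1 ℚ./ suc a ℚ.+ harmonic (suc a) l

-- log k = ∫₁ᵏ dx/x.  The right-endpoint Riemann sum of 1/x on [1,k] with
-- step 1/N is Σ_{j=1}^{(k-1)N} (1/N)·1/(1+j/N) = Σ_{j=1}^{(k-1)N} 1/(N+j);
-- the n-th approximation takes N = n+1.
logSeq : ℕ → ℕ → ℚ
logSeq k n = harmonic (suc n) ((k ℕ.∸ 1) ℕ.* suc n)

h : ℕ → ℚ
h n = + 1 ℚ./ suc n

ι : ℕ → ℚ
ι n = + n ℚ./ 1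

h-pos : ∀ n → 0ℚ ℚ.< h n
h-pos n = ℚₚ.positive⁻¹ (h n) {{ℚₚ.normalize-pos 1 (suc n)}}

ι-+ : ∀ m n → ι (m ℕ.+ n) ≡ ι m ℚ.+ ι n
ι-+ m n = ℚₚ.toℚᵘ-injective (begin-equality
  ℚ.toℚᵘ (ι (m ℕ.+ n))                       ≃⟨ ℚₚ.toℚᵘ-fromℚᵘ (ℚᵘ.mkℚᵘ (+ (m ℕ.+ n)) 0) ⟩
  ℚᵘ.mkℚᵘ (+ (m ℕ.+ n)) 0                    ≃⟨ ℚᵘ.*≡* (cong (ℤ._* + 1) (sym (cong₂ ℤ._+_ (ℤₚ.*-identityʳ (+ m)) (ℤₚ.*-identityʳ (+ n))))) ⟩
  ℚᵘ.mkℚᵘ (+ m) 0 ℚᵘ.+ ℚᵘ.mkℚᵘ (+ n) 0       ≃⟨ ℚᵘₚ.+-cong (ℚₚ.toℚᵘ-fromℚᵘ (ℚᵘ.mkℚᵘ (+ m) 0)) (ℚₚ.toℚᵘ-fromℚᵘ (ℚᵘ.mkℚᵘ (+ n) 0)) ⟨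
  ℚ.toℚᵘ (ι m) ℚᵘ.+ ℚ.toℚᵘ (ι n)             ≃⟨ ℚₚ.toℚᵘ-homo-+ (ι m) (ι n) ⟨
  ℚ.toℚᵘ (ι m ℚ.+ ι n)                       ∎)
  where open ℚᵘₚ.≤-Reasoning

ι-* : ∀ m n → ι (m ℕ.* n) ≡ ι m ℚ.* ι n
ι-* m n = ℚₚ.toℚᵘ-injective (begin-equality
  ℚ.toℚᵘ (ι (m ℕ.* n))                       ≃⟨ ℚₚ.toℚᵘ-fromℚᵘ (ℚᵘ.mkℚᵘ (+ (m ℕ.* n)) 0) ⟩
  ℚᵘ.mkℚᵘ (+ (m ℕ.* n)) 0                    ≃⟨ ℚᵘ.*≡* (cong (ℤ._* + 1) (ℤₚ.pos-* m n)) ⟩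
  ℚᵘ.mkℚᵘ (+ m) 0 ℚᵘ.* ℚᵘ.mkℚᵘ (+ n) 0       ≃⟨ ℚᵘₚ.*-cong (ℚₚ.toℚᵘ-fromℚᵘ (ℚᵘ.mkℚᵘ (+ m) 0)) (ℚₚ.toℚᵘ-fromℚᵘ (ℚᵘ.mkℚᵘ (+ n) 0)) ⟨
  ℚ.toℚᵘ (ι m) ℚᵘ.* ℚ.toℚᵘ (ι n)             ≃⟨ ℚₚ.toℚᵘ-homo-* (ι m) (ι n) ⟨
  ℚ.toℚᵘ (ι m ℚ.* ι n)                       ∎)
  where open ℚᵘₚ.≤-Reasoning

ι*h : ∀ n → ι (suc n) ℚ.* h n ≡ 1ℚ
ι*h n = ℚₚ.toℚᵘ-injective (begin-equality
  ℚ.toℚᵘ (ι (suc n) ℚ.* h n)                 ≃⟨ ℚₚ.toℚᵘ-homo-* (ι (suc n)) (h n) ⟩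
  ℚ.toℚᵘ (ι (suc n)) ℚᵘ.* ℚ.toℚᵘ (h n)       ≃⟨ ℚᵘₚ.*-cong (ℚₚ.toℚᵘ-fromℚᵘ (ℚᵘ.mkℚᵘ (+ suc n) 0)) (ℚₚ.toℚᵘ-fromℚᵘ (ℚᵘ.mkℚᵘ (+ 1) n)) ⟩
  ℚᵘ.mkℚᵘ (+ suc n) 0 ℚᵘ.* ℚᵘ.mkℚᵘ (+ 1) n   ≃⟨ ℚᵘ.*≡* (trans (ℤₚ.*-identityʳ _) (trans (ℤₚ.*-comm (+ suc n) (+ 1)) (cong (λ z → + 1 ℤ.* + z) (sym (ℕₚ.+-identityʳ (suc n)))))) ⟩
  ℚᵘ.1ℚᵘ                                     ∎)
  where open ℚᵘₚ.≤-Reasoning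

ι-mono : ∀ {m n} → m ℕ.≤ n → ι m ℚ.≤ ι n
ι-mono {m} {n} m≤n = ℚₚ.toℚᵘ-cancel-≤ (begin
  ℚ.toℚᵘ (ι m)     ≃⟨ ℚₚ.toℚᵘ-fromℚᵘ (ℚᵘ.mkℚᵘ (+ m) 0) ⟩
  ℚᵘ.mkℚᵘ (+ m) 0  ≤⟨ ℚᵘ.*≤* (ℤₚ.*-monoʳ-≤-nonNeg (+ 1) (ℤ.+≤+ m≤n)) ⟩
  ℚᵘ.mkℚᵘ (+ n) 0  ≃⟨ ℚₚ.toℚᵘ-fromℚᵘ (ℚᵘ.mkℚᵘ (+ n) 0) ⟨
  ℚ.toℚᵘ (ι n)     ∎)
  where open ℚᵘₚ.≤-Reasoning

h-anti : ∀ {m n} → m ℕ.≤ n → h n ℚ.≤ h m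
h-anti {m} {n} m≤n = begin
  h n                              ≡⟨ ℚₚ.*-identityʳ (h n) ⟨
  h n ℚ.* 1ℚ                       ≡⟨ cong (h n ℚ.*_) (ι*h m) ⟨
  h n ℚ.* (ι (suc m) ℚ.* h m)      ≤⟨ ℚₚ.*-monoˡ-≤-nonNeg (h n) {{ℚ.nonNegative (ℚₚ.<⇒≤ (h-pos n))}}
                                        (ℚₚ.*-monoʳ-≤-nonNeg (h m) {{ℚ.nonNegative (ℚₚ.<⇒≤ (h-pos m))}} (ι-mono (s≤s m≤n))) ⟩
  h n ℚ.* (ι (suc n) ℚ.* h m)      ≡⟨ solve 3 (λ a b c → a :* (b :* c) := (b :* a) :* c) refl (h n) (ι (suc n)) (h m) ⟩
  (ι (suc n) ℚ.* h n) ℚ.* h m      ≡⟨ cong (ℚ._* h m) (ι*h n) ⟩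
  1ℚ ℚ.* h m                       ≡⟨ ℚₚ.*-identityˡ (h m) ⟩
  h m                              ∎
  where
  open ℚₚ.≤-Reasoning
  open +-*-Solver

ι*h-cancel : ∀ a M c → suc c ≡ suc a ℕ.* M → ι M ℚ.* h c ≡ h a
ι*h-cancel a M c eq = begin
  ι M ℚ.* h c                              ≡⟨ ℚₚ.*-identityˡ _ ⟨
  1ℚ ℚ.* (ι M ℚ.* h c)                     ≡⟨ cong (ℚ._* (ι M ℚ.* h c)) (ι*h a) ⟨
  (ι (suc a) ℚ.* h a) ℚ.* (ι M ℚ.* h c)    ≡⟨ solve 4 (λ x y z w → (x :* y) :* (z :* w) := y :* ((x :* z) :* w)) refl (ι (suc a)) (h a) (ι M) (h c) ⟩
  h a ℚ.* ((ι (suc a) ℚ.* ι M) ℚ.* h c)    ≡⟨ cong (λ z → h a ℚ.* (z ℚ.* h c)) (trans (sym (ι-* (suc a) M)) (cong ι (sym eq))) ⟩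
  h a ℚ.* (ι (suc c) ℚ.* h c)              ≡⟨ cong (h a ℚ.*_) (ι*h c) ⟩
  h a ℚ.* 1ℚ                               ≡⟨ ℚₚ.*-identityʳ (h a) ⟩
  h a                                      ∎
  where
  open Relation.Binary.PropositionalEquality.≡-Reasoning
  open +-*-Solver

ι-suc-* : ∀ l p → ι (suc l) ℚ.* p ≡ p ℚ.+ ι l ℚ.* p
ι-suc-* l p = trans (cong (ℚ._* p) (ι-+ 1 l))
  (trans (ℚₚ.*-distribʳ-+ p 1ℚ (ι l)) (cong (ℚ._+ ι l ℚ.* p) (ℚₚ.*-identityˡ p)))

harmonic-lower : ∀ b l c → b ℕ.+ l ℕ.≤ suc c → ι l ℚ.* h c ℚ.≤ harmonic b l
harmonic-lower b zero    c _  = ℚₚ.≤-reflexive (ℚₚ.*-zeroˡ (h c))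
harmonic-lower b (suc l) c le = ℚₚ.≤-trans (ℚₚ.≤-reflexive (ι-suc-* l (h c)))
  (ℚₚ.+-mono-≤ (h-anti (ℕₚ.≤-trans (ℕₚ.m≤m+n b l) (ℕₚ.≤-pred le′))) (harmonic-lower (suc b) l c le′))
  where le′ = subst (ℕ._≤ suc c) (ℕₚ.+-suc b l) le

harmonic-upper : ∀ b l c → c ℕ.≤ b → harmonic b l ℚ.≤ ι l ℚ.* h c
harmonic-upper b zero    c _  = ℚₚ.≤-reflexive (sym (ℚₚ.*-zeroˡ (h c)))
harmonic-upper b (suc l) c le = ℚₚ.≤-trans
  (ℚₚ.+-mono-≤ (h-anti le) (harmonic-upper (suc b) l c (ℕₚ.m≤n⇒m≤1+n le)))
  (ℚₚ.≤-reflexive (sym (ι-suc-* l (h c))))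

harmonic-nonneg : ∀ b l → 0ℚ ℚ.≤ harmonic b l
harmonic-nonneg b zero    = ℚₚ.≤-refl
harmonic-nonneg b (suc l) = ℚₚ.+-mono-≤ (ℚₚ.<⇒≤ (h-pos b)) (harmonic-nonneg (suc b) l)

harmonic-+ : ∀ a l l′ → harmonic a (l ℕ.+ l′) ≡ harmonic a l ℚ.+ harmonic (a ℕ.+ l) l′
harmonic-+ a zero    l′ = trans (cong (λ z → harmonic z l′) (sym (ℕₚ.+-identityʳ a))) (sym (ℚₚ.+-identityˡ _))
harmonic-+ a (suc l) l′ = trans
  (cong (h a ℚ.+_) (trans (harmonic-+ (suc a) l l′)
    (cong (λ z → harmonic (suc a) l ℚ.+ harmonic z l′) (sym (ℕₚ.+-suc a l)))))
  (sym (ℚₚ.+-assoc (h a) _ _))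

harmonic-block : ∀ a l M → harmonic (a ℕ.* M) (suc l ℕ.* M) ≡
                 harmonic (a ℕ.* M) M ℚ.+ harmonic (suc a ℕ.* M) (l ℕ.* M)
harmonic-block a l M = trans (harmonic-+ (a ℕ.* M) M (l ℕ.* M))
  (cong (λ z → harmonic (a ℕ.* M) M ℚ.+ harmonic z (l ℕ.* M)) (ℕₚ.+-comm (a ℕ.* M) M))

refine-lower : ∀ a l M → harmonic a l ℚ.≤ harmonic (a ℕ.* suc M) (l ℕ.* suc M)
refine-lower a zero    M = ℚₚ.≤-refl
refine-lower a (suc l) M = ℚₚ.≤-trans
  (ℚₚ.+-mono-≤
    (ℚₚ.≤-trans (ℚₚ.≤-reflexive (sym (ι*h-cancel a (suc M) _ refl)))
      (harmonic-lower (a ℕ.* suc M) (suc M) _ (ℕₚ.≤-reflexive (ℕₚ.+-comm (a ℕ.* suc M) (suc M)))))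
    (refine-lower (suc a) l M))
  (ℚₚ.≤-reflexive (sym (harmonic-block a l (suc M))))

refine-upper : ∀ a l M → harmonic (suc a ℕ.* suc M) (l ℕ.* suc M) ℚ.+ h (a ℕ.+ l)
                         ℚ.≤ harmonic (suc a) l ℚ.+ h a
refine-upper a zero    M = ℚₚ.≤-reflexive (cong (λ z → 0ℚ ℚ.+ h z) (ℕₚ.+-identityʳ a))
refine-upper a (suc l) M = begin
  harmonic (suc a ℕ.* suc M) (suc l ℕ.* suc M) ℚ.+ h (a ℕ.+ suc l)
    ≡⟨ cong₂ (λ z w → z ℚ.+ h w) (harmonic-block (suc a) l (suc M)) (ℕₚ.+-suc a l) ⟩
  (harmonic (suc a ℕ.* suc M) (suc M) ℚ.+ H) ℚ.+ h (suc a ℕ.+ l)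
    ≡⟨ ℚₚ.+-assoc (harmonic (suc a ℕ.* suc M) (suc M)) H (h (suc a ℕ.+ l)) ⟩
  harmonic (suc a ℕ.* suc M) (suc M) ℚ.+ (H ℚ.+ h (suc a ℕ.+ l))
    ≤⟨ ℚₚ.+-mono-≤
         (ℚₚ.≤-trans (harmonic-upper (suc a ℕ.* suc M) (suc M) _ (ℕₚ.n≤1+n _))
           (ℚₚ.≤-reflexive (ι*h-cancel a (suc M) _ refl)))
         (refine-upper (suc a) l M) ⟩
  h a ℚ.+ (harmonic (suc (suc a)) l ℚ.+ h (suc a))
    ≡⟨ solve 3 (λ x y z → x :+ (y :+ z) := (z :+ y) :+ x) refl (h a) (harmonic (suc (suc a)) l) (h (suc a)) ⟩
  (h (suc a) ℚ.+ harmonic (suc (suc a)) l) ℚ.+ h a ∎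
  where
  open ℚₚ.≤-Reasoning
  open +-*-Solver
  H = harmonic (suc (suc a) ℕ.* suc M) (l ℕ.* suc M)

logSeq-close : ∀ k m n → logSeq k m ℚ.≤ logSeq k n ℚ.+ h n
logSeq-close k m n = begin
  harmonic (suc m) (k′ ℕ.* suc m)
    ≤⟨ refine-lower (suc m) (k′ ℕ.* suc m) n ⟩
  harmonic (suc m ℕ.* suc n) (k′ ℕ.* suc m ℕ.* suc n)
    ≡⟨ cong₂ harmonic (ℕₚ.*-comm (suc m) (suc n))
         (trans (ℕₚ.*-assoc k′ (suc m) (suc n))
           (trans (cong (k′ ℕ.*_) (ℕₚ.*-comm (suc m) (suc n))) (sym (ℕₚ.*-assoc k′ (suc n) (suc m))))) ⟩
  harmonic (suc n ℕ.* suc m) (k′ ℕ.* suc n ℕ.* suc m)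
    ≡⟨ ℚₚ.+-identityʳ _ ⟨
  harmonic (suc n ℕ.* suc m) (k′ ℕ.* suc n ℕ.* suc m) ℚ.+ 0ℚ
    ≤⟨ ℚₚ.+-monoʳ-≤ (harmonic (suc n ℕ.* suc m) (k′ ℕ.* suc n ℕ.* suc m)) (ℚₚ.<⇒≤ (h-pos (n ℕ.+ k′ ℕ.* suc n))) ⟩
  harmonic (suc n ℕ.* suc m) (k′ ℕ.* suc n ℕ.* suc m) ℚ.+ h (n ℕ.+ k′ ℕ.* suc n)
    ≤⟨ refine-upper n (k′ ℕ.* suc n) m ⟩
  harmonic (suc n) (k′ ℕ.* suc n) ℚ.+ h n ∎
  where
  open ℚₚ.≤-Reasoning
  k′ = k ℕ.∸ 1

archimedean : ∀ ε → 0ℚ ℚ.< ε → ∃[ N ] h N ℚ.< ε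
archimedean (ℚ.mkℚ (+ zero) d _) 0<ε with ℚ.positive 0<ε
... | ()
archimedean ε@(ℚ.mkℚ (+ suc p) d _) 0<ε = suc d , ℚₚ.toℚᵘ-cancel-< (begin-strict
  ℚ.toℚᵘ (h (suc d))         ≃⟨ ℚₚ.toℚᵘ-fromℚᵘ (ℚᵘ.mkℚᵘ (+ 1) (suc d)) ⟩
  ℚᵘ.mkℚᵘ (+ 1) (suc d)      <⟨ ℚᵘ.*<* (subst₂ ℤ._<_ (sym (ℤₚ.*-identityˡ (+ suc d))) (ℤₚ.pos-* (suc p) (suc (suc d)))
                                  (ℤ.+<+ (ℕₚ.m≤n⇒m≤n+o (p ℕ.* suc (suc d)) ℕₚ.≤-refl))) ⟩
  ℚᵘ.mkℚᵘ (+ suc p) d        ∎)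
  where open ℚᵘₚ.≤-Reasoning
archimedean (ℚ.mkℚ ℤ.-[1+ _ ] d _) 0<ε with ℚ.positive 0<ε
... | ()

log : (k : ℕ) → .{{NonZero k}} → ℝ
log k = mkℝ (logSeq k) λ ε 0<ε →
  let N , hN<ε = archimedean ε 0<ε
  in N , λ m n m≥ n≥ → ∣-∣-bound {logSeq k m} {logSeq k n}
       (step m n (ℚₚ.≤-<-trans (h-anti n≥) hN<ε)) (step n m (ℚₚ.≤-<-trans (h-anti m≥) hN<ε))
  where
  open +-*-Solver
  step : ∀ {ε} m n → h n ℚ.< ε → logSeq k m ℚ.- logSeq k n ℚ.< ε
  step {ε} m n hn<ε = begin-strict
    logSeq k m ℚ.- logSeq k n             ≤⟨ ℚₚ.+-monoˡ-≤ (ℚ.- logSeq k n) (logSeq-close k m n) ⟩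
    logSeq k n ℚ.+ h n ℚ.- logSeq k n     ≡⟨ solve 2 (λ a b → a :+ b :- a := b) refl (logSeq k n) (h n) ⟩
    h n                                   <⟨ hn<ε ⟩
    ε                                     ∎
    where open ℚₚ.≤-Reasoning

log-gap : ∀ {k m} .{{_ : NonZero k}} .{{_ : NonZero m}} → k ℕ.< m → 0ℝ <ℝ log m -ℝ log k
log-gap {suc k} {suc m} (s≤s k<m) = h m , h-pos m , 0 , λ n _ → gap n
  where
  r = m ℕ.∸ suc k
  m≡ : m ≡ k ℕ.+ suc r
  m≡ = trans (sym (ℕₚ.m+[n∸m]≡n k<m)) (sym (ℕₚ.+-suc k r))
  gap : ∀ n → 0ℚ ℚ.+ h m ℚ.≤ logSeq (suc m) n ℚ.- logSeq (suc k) n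
  gap n = begin
    0ℚ ℚ.+ h m
      ≡⟨ ℚₚ.+-identityˡ (h m) ⟩
    h m
      ≡⟨ ι*h-cancel m M _ refl ⟨
    ι M ℚ.* h (n ℕ.+ m ℕ.* M)
      ≤⟨ harmonic-lower b M _ le ⟩
    harmonic b M
      ≡⟨ ℚₚ.+-identityʳ _ ⟨
    harmonic b M ℚ.+ 0ℚ
      ≤⟨ ℚₚ.+-monoʳ-≤ (harmonic b M) (harmonic-nonneg (b ℕ.+ M) (r ℕ.* M)) ⟩
    harmonic b M ℚ.+ harmonic (b ℕ.+ M) (r ℕ.* M)
      ≡⟨ harmonic-+ b M (r ℕ.* M) ⟨
    harmonic b (suc r ℕ.* M)
      ≡⟨ solve 2 (λ x y → y := x :+ y :- x) refl (harmonic M (k ℕ.* M)) (harmonic b (suc r ℕ.* M)) ⟩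
    harmonic M (k ℕ.* M) ℚ.+ harmonic b (suc r ℕ.* M) ℚ.- harmonic M (k ℕ.* M)
      ≡⟨ cong (ℚ._- harmonic M (k ℕ.* M)) (harmonic-+ M (k ℕ.* M) (suc r ℕ.* M)) ⟨
    harmonic M (k ℕ.* M ℕ.+ suc r ℕ.* M) ℚ.- harmonic M (k ℕ.* M)
      ≡⟨ cong (λ z → harmonic M z ℚ.- harmonic M (k ℕ.* M))
           (trans (sym (ℕₚ.*-distribʳ-+ M k (suc r))) (cong (ℕ._* M) (sym m≡))) ⟩
    harmonic M (m ℕ.* M) ℚ.- harmonic M (k ℕ.* M) ∎
    where
    open ℚₚ.≤-Reasoning
    open +-*-Solver
    M = suc n
    b = M ℕ.+ k ℕ.* M
    le : b ℕ.+ M ℕ.≤ suc m ℕ.* M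
    le = ℕₚ.≤-trans (ℕₚ.≤-reflexive (ℕₚ.+-comm b M)) (ℕₚ.*-monoˡ-≤ M (s≤s k<m))

------------------------------------------------------------------------
-- Finite simple graphs

record Graph : Set₁ where
  infix 4 _∼_ _≟_ _∼?_
  field
    V        : Set
    _≟_      : DecidableEquality V
    vertices : List V
    complete : ∀ v → v ∈ vertices
    unique   : Unique vertices
    _∼_      : V → V → Set
    _∼?_     : B.Decidable _∼_
    ∼-sym    : Symmetric _∼_
    ∼-irrefl : Irreflexive _≡_ _∼_

open Graph public using (V)

module _ (G : Graph) where
  open Graph G hiding (V)

  order : ℕ
  order = length vertices

  Connected : Set
  Connected = ∀ v w → Star _∼_ v w

  Regular : ℕ → Set
  Regular d = ∀ v → length (filter (v ∼?_) vertices) ≡ d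

  card : {A : Pred (V G) 0ℓ} → Decidable A → ℕ
  card A? = length (filter A? vertices)

  -- e(A, Aᶜ): an edge with exactly one endpoint in A is counted once, as the
  -- ordered pair (x , y) with x ∈ A and y ∉ A.
  boundary : {A : Pred (V G) 0ℓ} → Decidable A → ℕ
  boundary A? = length (filter (λ (x , y) → A? x ×-dec ¬? (A? y) ×-dec (x ∼? y))
                               (cartesianProduct vertices vertices))

combinations : {X : Set} → ℕ → List X → List (List X)
combinations zero    _        = [] ∷ []
combinations (suc k) []       = []
combinations (suc k) (x ∷ xs) = map (x ∷_) (combinations k xs) ++ combinations (suc k) xs

-- The value at [] is a placeholder.
minimum : List ℚ → ℚ
minimum []       = 0ℚ
minimum (q ∷ qs) = foldr _⊓_ q qs

-- i_k(G); the minimum ranges over a nonempty list exactly when k ≤ order G.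
isoperimetric : (G : Graph) (k : ℕ) → .{{NonZero k}} → ℚ
isoperimetric G k = minimum
  (map (λ A → + boundary G (λ v → v ∈? A) ℚ./ k) (combinations k (Graph.vertices G)))
  where open DecMembership (Graph._≟_ G) using (_∈?_)

------------------------------------------------------------------------
-- Powers of a graph

vectors : {X : Set} → List X → ∀ n → List (Vec X n)
vectors xs zero    = [] ∷ []
vectors xs (suc n) = cartesianProductWith _∷_ xs (vectors xs n)

infixr 8 _□^_

_□^_ : Graph → ℕ → Graph
G □^ n = record
  { V        = Vec (V G) n
  ; _≟_      = Vecₚ.≡-dec _≟_
  ; vertices = vectors vertices n
  ; complete = vectors-complete
  ; unique   = vectors-unique n
  ; _∼_      = λ u v → ∃[ j ] lookup u j ∼ lookup v j ×
                              (∀ l → l ≢ j → lookup u l ≡ lookup v l)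
  ; _∼?_     = λ u v → Finₚ.any? λ j → (lookup u j ∼? lookup v j) ×-dec
                              Finₚ.all? (λ l → ¬? (l Finₚ.≟ j) →-dec (lookup u l ≟ lookup v l))
  ; ∼-sym    = λ (j , e , eqs) → j , ∼-sym e , λ l l≢j → sym (eqs l l≢j)
  ; ∼-irrefl = λ { refl (j , e , _) → ∼-irrefl refl e }
  }
  where
  open Graph G hiding (V)
  vectors-complete : ∀ {n} (v : Vec (V G) n) → v ∈ vectors vertices n
  vectors-complete []      = here refl
  vectors-complete (x ∷ v) = ∈-cartesianProductWith⁺ _∷_ (complete x) (vectors-complete v)
  vectors-unique : ∀ n → Unique (vectors vertices n)
  vectors-unique zero    = All.[] AllPairs.∷ AllPairs.[]
  vectors-unique (suc n) = cartesianProductWith⁺ _∷_ Vecₚ.∷-injective unique (vectors-unique n)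

-- {u}^t × V(G)^(n-t)
Block : (G : Graph) (u : V G) (n t : ℕ) → Pred (V (G □^ n)) 0ℓ
Block G u n t v = ∀ (j : Fin n) → toℕ j ℕ.< t → lookup v j ≡ u

Block? : (G : Graph) (u : V G) (n t : ℕ) → Decidable (Block G u n t)
Block? G u n t v = Finₚ.all? λ j → (toℕ j ℕₚ.<? t) →-dec Graph._≟_ G (lookup v j) u

------------------------------------------------------------------------
-- The lines ℓ_k and the intercept y_G

module _ (G : Graph) (k : ℕ) .{{_ : NonZero k}} (k<m : k ℕ.< order G) where
  private
    instance
      m≢0 : NonZero (order G)
      m≢0 = ℕ.>-nonZero (ℕₚ.≤-<-trans z≤n k<m)

    1/gap : ℝ
    1/gap = inverse (log (order G) -ℝ log k) (log-gap k<m)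

  line : ℝ → ℝ
  line x = fromℚ (isoperimetric G k) *ℝ (log (order G) -ℝ x) *ℝ 1/gap

  slope : ℝ
  slope = (0ℝ -ℝ fromℚ (isoperimetric G k)) *ℝ 1/gap

  yIntercept : ℝ
  yIntercept = line 0ℝ

HasLargestSlope : (G : Graph) (k : ℕ) .{{_ : NonZero k}} → k ℕ.< order G → Set
HasLargestSlope G k k<m =
  ∀ j .{{_ : NonZero j}} (j<m : j ℕ.< order G) → slope G j j<m ≤ℝ slope G k k<m

-- k is the index k* of the definition of y_G.
record IsOptimal (G : Graph) (k : ℕ) .{{_ : NonZero k}} (k<m : k ℕ.< order G) : Set where
  field
    largest  : HasLargestSlope G k k<m
    smallest : ∀ j .{{_ : NonZero j}} (j<m : j ℕ.< order G) → HasLargestSlope G j j<m → k ℕ.≤ j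

{-# OPTIONS --safe #-}
-- Let c = i_{k*}/(log m - log k*), minus the slope of the optimal line, so y_G = c log m and
-- i_k ≥ c (log m - log k) for all k.  For X uniform on A ⊆ V(G)ⁿ, the edges of direction j
-- leaving A number at least c |A| (log m - H(X_j ∣ X_l, l ≠ j)); as these conditional
-- entropies sum to at most H(X) = log |A|, we get e(A) ≥ c |A| (n log m - log |A|), which is
-- e(B_t) when |A| = m^(n-t) and c log m = d.  Everything is exponentiated (and c eliminated
-- through y_G = d), so that it becomes an inequality of natural numbers; logarithms only
-- enter in translating the hypotheses on y_G.
-- Conversely, if y_G < d and S attains i_{k*}, then products of many copies of S with a set
-- in boundedly many further coordinates, corrected by few points to have size m^(n-t), have
-- smaller boundary than B_t.
module Submission where

open import Data.Bool.Base using (Bool; true; false; _∧_; _∨_; not; if_then_else_; T)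
open import Data.Bool.Properties using (∧-assoc; ∧-identityʳ; ∧-zeroʳ)
open import Data.Fin.Base as Fin using (Fin)
import Data.Integer.Base as ℤ
import Data.Integer.Properties as ℤₚ
open import Data.List.Base
  using (List; []; _∷_; _++_; length; map; filter; filterᵇ; foldr; cartesianProduct; cartesianProductWith)
import Data.List.Membership.DecPropositional as DecMembership
open import Data.List.Membership.Propositional using (_∈_)
open import Data.List.Membership.Propositional.Properties
  using (∈-map⁺; ∈-map⁻; ∈-++⁺ˡ; ∈-++⁺ʳ; ∈-++⁻; ∈-filter⁺; ∈-filter⁻)
open import Data.List.Properties using (map-cong; map-++; map-∘; length-map)
open import Data.List.Relation.Unary.All as All using ([]; _∷_)
open import Data.List.Relation.Unary.AllPairs using ([]; _∷_)
open import Data.List.Relation.Unary.Any using (here; there)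
open import Data.List.Relation.Unary.Unique.Propositional using (Unique)
open import Data.Nat hiding (_≟_)
open import Data.Nat.DivMod using (m≡m%n+[m/n]*n; m%n<n; /-monoˡ-≤; m*n/n≡m)
open import Data.Nat.ListAction using (sum; product)
open import Data.Nat.ListAction.Properties using (sum-++; product-++)
open import Data.Nat.Properties hiding (_≟_)
open import Data.Nat.Solver using () renaming (module +-*-Solver to ℕ-Solver)
open import Data.Product using (∃-syntax; Σ-syntax; _×_; _,_; proj₁; proj₂)
open import Data.Rational as ℚ using (ℚ; 0ℚ; 1ℚ; ½)
import Data.Rational.Properties as ℚₚ
open import Data.Rational.Solver using () renaming (module +-*-Solver to ℚ-Solver)
import Data.Rational.Unnormalised as ℚᵘ
import Data.Rational.Unnormalised.Properties as ℚᵘₚ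
open import Data.Sum using (_⊎_; inj₁; inj₂)
open import Data.Vec.Base using ([]; _∷_; lookup)
open import Data.Vec.Relation.Binary.Pointwise.Extensional using (ext; Pointwise-≡⇒≡)
open import Function using (_∘_; _⇔_; mk⇔)
open import Level using (0ℓ)
open import Relation.Binary.Definitions using (DecidableEquality)
open import Relation.Binary.PropositionalEquality
open import Relation.Nullary using (¬_; does; yes; no; contradiction; T?)
open import Relation.Nullary.Decidable using (does-⇔; _×-dec_; _⊎-dec_; dec-true; dec-false; ¬?)
open import Relation.Unary using (Pred; Decidable)
open import Defs

-- Finite sums and products

-- For X uniform on A, the number |A| H(X_j ∣ X_l, l ≠ j) is the sum of s log s over the sizes s of
-- the lines of A in direction j; this is where the products of s^s come from. Splitting off one
-- coordinate at a time leaves only an inequality for two variables, the second being the whole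
-- remaining vector. In the converse the obstacle is that |S|^p is in general not a power of m, and
-- a correcting point costs up to (p + r) d edges, which grows with the number p of copies just as
-- the gain does. The factor W in r further coordinates makes the correction less than a 1/w part of
-- the set, w = |W|, which lowers its rate of growth below that of the gain. Hence the order of
-- choices, with k = |S| and p = P s: P from the ratio in the strict inequality for S, then r so
-- that w exceeds k d P, and last s to outweigh what does not grow with p. Since w depends on p,
-- only the bounds m^(r-1) ≤ w ≤ m^r are available when s is chosen.

private variable
  X Y Z : Set

∑ ∏ : List X → (X → ℕ) → ℕ
∑ xs f = sum (map f xs)
∏ xs f = product (map f xs)

⟦_⟧ : Bool → ℕ
⟦ b ⟧ = if b then 1 else 0

count : List X → (X → Bool) → ℕ
count xs A = ∑ xs (λ x → ⟦ A x ⟧)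

⟦⟧≤1 : ∀ b → ⟦ b ⟧ ≤ 1
⟦⟧≤1 true  = ≤-refl
⟦⟧≤1 false = z≤n

⟦∧⟧ : ∀ a b → ⟦ a ∧ b ⟧ ≡ ⟦ a ⟧ * ⟦ b ⟧
⟦∧⟧ true  b = sym (*-identityˡ ⟦ b ⟧)
⟦∧⟧ false b = refl

∑-cong : ∀ {f g : X → ℕ} → (∀ x → f x ≡ g x) → ∀ xs → ∑ xs f ≡ ∑ xs g
∑-cong f≗g xs = cong sum (map-cong f≗g xs)

∏-cong : ∀ {f g : X → ℕ} → (∀ x → f x ≡ g x) → ∀ xs → ∏ xs f ≡ ∏ xs g
∏-cong f≗g xs = cong product (map-cong f≗g xs)

∑-mono : ∀ {f g : X → ℕ} → (∀ x → f x ≤ g x) → ∀ xs → ∑ xs f ≤ ∑ xs g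
∑-mono f≤g []       = z≤n
∑-mono f≤g (x ∷ xs) = +-mono-≤ (f≤g x) (∑-mono f≤g xs)

∏-mono : ∀ {f g : X → ℕ} → (∀ x → f x ≤ g x) → ∀ xs → ∏ xs f ≤ ∏ xs g
∏-mono f≤g []       = ≤-refl
∏-mono f≤g (x ∷ xs) = *-mono-≤ (f≤g x) (∏-mono f≤g xs)

∑-+ : ∀ (f g : X → ℕ) xs → ∑ xs (λ x → f x + g x) ≡ ∑ xs f + ∑ xs g
∑-+ f g []       = refl
∑-+ f g (x ∷ xs) = trans (cong (f x + g x +_) (∑-+ f g xs))
  (solve 4 (λ a b c d → a :+ b :+ (c :+ d) := a :+ c :+ (b :+ d)) refl (f x) (g x) (∑ xs f) (∑ xs g))
  where open ℕ-Solver

∏-* : ∀ (f g : X → ℕ) xs → ∏ xs (λ x → f x * g x) ≡ ∏ xs f * ∏ xs g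
∏-* f g []       = refl
∏-* f g (x ∷ xs) = trans (cong (f x * g x *_) (∏-* f g xs))
  (solve 4 (λ a b c d → a :* b :* (c :* d) := a :* c :* (b :* d)) refl (f x) (g x) (∏ xs f) (∏ xs g))
  where open ℕ-Solver

∑-*ˡ : ∀ c (f : X → ℕ) xs → ∑ xs (λ x → c * f x) ≡ c * ∑ xs f
∑-*ˡ c f []       = sym (*-zeroʳ c)
∑-*ˡ c f (x ∷ xs) = trans (cong (c * f x +_) (∑-*ˡ c f xs)) (sym (*-distribˡ-+ c (f x) (∑ xs f)))

∑-*ʳ : ∀ c (f : X → ℕ) xs → ∑ xs (λ x → f x * c) ≡ ∑ xs f * c
∑-*ʳ c f xs = trans (∑-cong (λ x → *-comm (f x) c) xs) (trans (∑-*ˡ c f xs) (*-comm c (∑ xs f)))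

∑-const : ∀ c (xs : List X) → ∑ xs (λ _ → c) ≡ length xs * c
∑-const c []       = refl
∑-const c (x ∷ xs) = cong (c +_) (∑-const c xs)

∑-zero : (xs : List X) → ∑ xs (λ _ → 0) ≡ 0
∑-zero xs = trans (∑-const 0 xs) (*-zeroʳ (length xs))

^-distribʳ-* : ∀ a b n → (a * b) ^ n ≡ a ^ n * b ^ n
^-distribʳ-* a b zero    = refl
^-distribʳ-* a b (suc n) = trans (cong (a * b *_) (^-distribʳ-* a b n))
  (solve 4 (λ a b c d → a :* b :* (c :* d) := a :* c :* (b :* d)) refl a b (a ^ n) (b ^ n))
  where open ℕ-Solver

∏-^ : ∀ (f : X → ℕ) c xs → ∏ xs (λ x → f x ^ c) ≡ ∏ xs f ^ c
∏-^ f c []       = sym (^-zeroˡ c)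
∏-^ f c (x ∷ xs) = trans (cong (f x ^ c *_) (∏-^ f c xs)) (sym (^-distribʳ-* (f x) (∏ xs f) c))

^-∑ : ∀ c (f : X → ℕ) xs → ∏ xs (λ x → c ^ f x) ≡ c ^ ∑ xs f
^-∑ c f []       = refl
^-∑ c f (x ∷ xs) = trans (cong (c ^ f x *_) (^-∑ c f xs)) (sym (^-distribˡ-+-* c (f x) (∑ xs f)))

∑-swap : ∀ (f : X → Y → ℕ) xs ys → ∑ xs (λ x → ∑ ys (f x)) ≡ ∑ ys (λ y → ∑ xs (λ x → f x y))
∑-swap f []       ys = sym (∑-zero ys)
∑-swap f (x ∷ xs) ys = trans (cong (∑ ys (f x) +_) (∑-swap f xs ys))
  (sym (∑-+ (f x) (λ y → ∑ xs (λ x → f x y)) ys))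

∏-one : (xs : List X) → ∏ xs (λ _ → 1) ≡ 1
∏-one []       = refl
∏-one (x ∷ xs) = trans (*-identityˡ _) (∏-one xs)

∏-swap : ∀ (f : X → Y → ℕ) xs ys → ∏ xs (λ x → ∏ ys (f x)) ≡ ∏ ys (λ y → ∏ xs (λ x → f x y))
∏-swap f []       ys = sym (∏-one ys)
∏-swap f (x ∷ xs) ys = trans (cong (∏ ys (f x) *_) (∏-swap f xs ys))
  (sym (∏-* (f x) (λ y → ∏ xs (λ x → f x y)) ys))

∑-cartesianProductWith : ∀ (f : X → Y → Z) (g : Z → ℕ) xs ys →
  ∑ (cartesianProductWith f xs ys) g ≡ ∑ xs (λ x → ∑ ys (λ y → g (f x y)))
∑-cartesianProductWith f g []       ys = refl
∑-cartesianProductWith f g (x ∷ xs) ys = begin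
  sum (map g (map (f x) ys ++ cartesianProductWith f xs ys))
    ≡⟨ cong sum (map-++ g (map (f x) ys) _) ⟩
  sum (map g (map (f x) ys) ++ map g (cartesianProductWith f xs ys))
    ≡⟨ sum-++ (map g (map (f x) ys)) _ ⟩
  sum (map g (map (f x) ys)) + ∑ (cartesianProductWith f xs ys) g
    ≡⟨ cong₂ _+_ (cong sum (sym (map-∘ ys))) (∑-cartesianProductWith f g xs ys) ⟩
  ∑ ys (g ∘ f x) + ∑ xs (λ x → ∑ ys (λ y → g (f x y))) ∎
  where open ≡-Reasoning

∏-cartesianProductWith : ∀ (f : X → Y → Z) (g : Z → ℕ) xs ys →
  ∏ (cartesianProductWith f xs ys) g ≡ ∏ xs (λ x → ∏ ys (λ y → g (f x y)))
∏-cartesianProductWith f g []       ys = refl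
∏-cartesianProductWith f g (x ∷ xs) ys = begin
  product (map g (map (f x) ys ++ cartesianProductWith f xs ys))
    ≡⟨ cong product (map-++ g (map (f x) ys) _) ⟩
  product (map g (map (f x) ys) ++ map g (cartesianProductWith f xs ys))
    ≡⟨ product-++ (map g (map (f x) ys)) _ ⟩
  product (map g (map (f x) ys)) * ∏ (cartesianProductWith f xs ys) g
    ≡⟨ cong₂ _*_ (cong product (sym (map-∘ ys))) (∏-cartesianProductWith f g xs ys) ⟩
  ∏ ys (g ∘ f x) * ∏ xs (λ x → ∏ ys (λ y → g (f x y))) ∎
  where open ≡-Reasoning

length-filter-count : ∀ {P : Pred X 0ℓ} (P? : Decidable P) xs → length (filter P? xs) ≡ count xs (does ∘ P?)
length-filter-count P? []       = refl
length-filter-count P? (x ∷ xs) with does (P? x)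
... | true  = cong suc (length-filter-count P? xs)
... | false = length-filter-count P? xs

-- The inequality of arithmetic and geometric means

2ab≤a²+b² : ∀ a b → 2 * (a * b) ≤ a * a + b * b
2ab≤a²+b² a b with ≤-total a b
... | inj₁ a≤b with m≤n⇒∃[o]m+o≡n a≤b
...   | k , refl = m+n≤o⇒m≤o _ (≤-reflexive
  (solve 2 (λ a k → con 2 :* (a :* (a :+ k)) :+ k :* k := a :* a :+ (a :+ k) :* (a :+ k)) refl a k))
  where open ℕ-Solver
2ab≤a²+b² a b | inj₂ b≤a with m≤n⇒∃[o]m+o≡n b≤a
...   | k , refl = m+n≤o⇒m≤o _ (≤-reflexive
  (solve 2 (λ b k → con 2 :* ((b :+ k) :* b) :+ k :* k := (b :+ k) :* (b :+ k) :+ b :* b) refl b k))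
  where open ℕ-Solver

-- Bernoulli's inequality (1 + x)^(n+1) ≥ 1 + (n + 1) x for a = b (1 + x), made homogeneous. The
-- induction multiplies 2ab ≤ a² + b² by (n + 1) b^n; adding n a b^(n+1) to both sides keeps
-- subtraction out.
bernoulli : ∀ a b n → suc n * (a * b ^ n) ≤ a ^ suc n + n * b ^ suc n
bernoulli a b zero    = ≤-reflexive (solve 1 (λ a → con 1 :* (a :* con 1) := a :* con 1 :+ con 0) refl a)
  where open ℕ-Solver
bernoulli a b (suc n) = +-cancelʳ-≤ (n * (a * (b * c))) _ _ (begin
  suc (suc n) * (a * (b * c)) + n * (a * (b * c))
    ≡⟨ solve 4 (λ a b c n → (con 2 :+ n) :* (a :* (b :* c)) :+ n :* (a :* (b :* c))
         := (con 1 :+ n) :* c :* (con 2 :* (a :* b))) refl a b c n ⟩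
  suc n * c * (2 * (a * b))
    ≤⟨ *-monoʳ-≤ (suc n * c) (2ab≤a²+b² a b) ⟩
  suc n * c * (a * a + b * b)
    ≡⟨ solve 4 (λ a b c n → (con 1 :+ n) :* c :* (a :* a :+ b :* b)
         := a :* ((con 1 :+ n) :* (a :* c)) :+ (con 1 :+ n) :* (b :* (b :* c))) refl a b c n ⟩
  a * (suc n * (a * c)) + suc n * (b * (b * c))
    ≤⟨ +-monoˡ-≤ _ (*-monoʳ-≤ a (bernoulli a b n)) ⟩
  a * (a ^ suc n + n * (b * c)) + suc n * (b * (b * c))
    ≡⟨ solve 5 (λ a b c n p → a :* (p :+ n :* (b :* c)) :+ (con 1 :+ n) :* (b :* (b :* c))
         := a :* p :+ (con 1 :+ n) :* (b :* (b :* c)) :+ n :* (a :* (b :* c))) refl a b c n (a ^ suc n) ⟩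
  a ^ suc (suc n) + suc n * b ^ suc (suc n) + n * (a * (b * c)) ∎)
  where
  open ≤-Reasoning
  open ℕ-Solver
  c = b ^ n

-- AM-GM for x and n copies of S/n, denominators cleared. It is `bernoulli` for n (x + S) and (n +
-- 1) S, whose ratio is that of the new mean (x + S)/(n + 1) to the old mean S/n.
am-gm-step : ∀ n S x → suc n ^ suc n * (x * S ^ n) ≤ n ^ n * (x + S) ^ suc n
am-gm-step zero      S x = begin
  1 * (x * 1)              ≡⟨ solve 1 (λ x → con 1 :* (x :* con 1) := x) refl x ⟩
  x                        ≤⟨ m≤m+n x S ⟩
  x + S                    ≡⟨ solve 1 (λ y → y := con 1 :* (y :* con 1)) refl (x + S) ⟩
  1 * ((x + S) * 1)        ∎
  where
  open ≤-Reasoning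
  open ℕ-Solver
am-gm-step n@(suc _) S x = *-cancelˡ-≤ n (+-cancelʳ-≤ (n * (N * S * (N ^ n * S ^ n))) _ _ (begin
  n * (N * N ^ n * (x * S ^ n)) + n * (N * S * (N ^ n * S ^ n))
    ≡⟨ solve 6 (λ n N p q x S → n :* (N :* p :* (x :* q)) :+ n :* (N :* S :* (p :* q))
         := N :* (n :* (x :+ S) :* (p :* q))) refl n N (N ^ n) (S ^ n) x S ⟩
  N * (n * (x + S) * (N ^ n * S ^ n))
    ≡⟨ cong (λ z → N * (n * (x + S) * z)) (^-distribʳ-* N S n) ⟨
  N * (n * (x + S) * (N * S) ^ n)
    ≤⟨ bernoulli (n * (x + S)) (N * S) n ⟩
  (n * (x + S)) ^ N + n * (N * S * (N * S) ^ n)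
    ≡⟨ cong₂ (λ z w → z + n * (N * S * w)) (^-distribʳ-* n (x + S) N) (^-distribʳ-* N S n) ⟩
  n * n ^ n * (x + S) ^ N + n * (N * S * (N ^ n * S ^ n))
    ≡⟨ cong (_+ n * (N * S * (N ^ n * S ^ n))) (*-assoc n (n ^ n) _) ⟩
  n * (n ^ n * (x + S) ^ N) + n * (N * S * (N ^ n * S ^ n)) ∎))
  where
  open ≤-Reasoning
  open ℕ-Solver
  N = suc n

am-gm : ∀ xs → length xs ^ length xs * product xs ≤ sum xs ^ length xs
am-gm []       = ≤-refl
am-gm (x ∷ xs) = n^n-cancel (length xs) (begin
  n ^ n * (suc n ^ suc n * (x * product xs))
    ≡⟨ solve 4 (λ p q x r → p :* (q :* (x :* r)) := q :* (x :* (p :* r))) refl (n ^ n) (suc n ^ suc n) x (product xs) ⟩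
  suc n ^ suc n * (x * (n ^ n * product xs))
    ≤⟨ *-monoʳ-≤ (suc n ^ suc n) (*-monoʳ-≤ x (am-gm xs)) ⟩
  suc n ^ suc n * (x * sum xs ^ n)
    ≤⟨ am-gm-step n (sum xs) x ⟩
  n ^ n * (x + sum xs) ^ suc n ∎)
  where
  open ≤-Reasoning
  open ℕ-Solver
  n = length xs
  n^n-cancel : ∀ n {a b} → n ^ n * a ≤ n ^ n * b → a ≤ b
  n^n-cancel zero      {a} {b} = subst₂ _≤_ (*-identityˡ a) (*-identityˡ b)
  n^n-cancel n@(suc _)         = *-cancelˡ-≤ (n ^ n) {{m^n≢0 n n}}

-- The hypothesis bounds the arithmetic mean by the length.
product≤length^length : ∀ xs → sum xs ≤ length xs * length xs → product xs ≤ length xs ^ length xs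
product≤length^length []           _  = ≤-refl
product≤length^length xs@(_ ∷ _) ∑≤ = *-cancelˡ-≤ (n ^ n) {{m^n≢0 n n}} (begin
  n ^ n * product xs  ≤⟨ am-gm xs ⟩
  sum xs ^ n          ≤⟨ ^-monoˡ-≤ n ∑≤ ⟩
  (n * n) ^ n         ≡⟨ ^-distribʳ-* n n n ⟩
  n ^ n * n ^ n       ∎)
  where
  open ≤-Reasoning
  n = length xs

module _ (b : X → Bool) (z : X → ℕ) where

  private
    selected : List X → List ℕ
    selected xs = map z (filterᵇ b xs)

  length-selected : ∀ xs → length (selected xs) ≡ count xs b
  length-selected xs = trans (length-map z (filterᵇ b xs)) (length-filter-count (T? ∘ b) xs)

  sum-selected : ∀ xs → sum (selected xs) ≡ ∑ xs (λ x → ⟦ b x ⟧ * z x)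
  sum-selected []       = refl
  sum-selected (x ∷ xs) with b x
  ... | true  = cong₂ _+_ (sym (*-identityˡ (z x))) (sum-selected xs)
  ... | false = sum-selected xs

  product-selected : ∀ xs → product (selected xs) ≡ ∏ xs (λ x → z x ^ ⟦ b x ⟧)
  product-selected []       = refl
  product-selected (x ∷ xs) with b x
  ... | true  = cong₂ _*_ (sym (^-identityʳ (z x))) (product-selected xs)
  ... | false = trans (product-selected xs) (sym (*-identityˡ _))

  -- AM-GM over the selected entries alone: an entry outside contributes the summand 0 and the
  -- factor z^0 = 1.
  ∏≤count^count : ∀ xs → ∑ xs (λ x → ⟦ b x ⟧ * z x) ≤ count xs b * count xs b →
                  ∏ xs (λ x → z x ^ ⟦ b x ⟧) ≤ count xs b ^ count xs b
  ∏≤count^count xs ∑≤ = subst₂ _≤_ (product-selected xs) (cong₂ _^_ ℓ ℓ)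
    (product≤length^length (selected xs) (subst₂ _≤_ (sym (sum-selected xs)) (sym (cong₂ _*_ ℓ ℓ)) ∑≤))
    where ℓ = length-selected xs

-- H(X₁ ∣ X₂) + H(X₂ ∣ X₁) ≤ H(X₁ , X₂) for (X₁ , X₂) uniform on the 1s of a 0-1
-- matrix, exponentiated.  By AM-GM it is enough that the 1s satisfy
-- ∑ r_x c_y ≤ N², and the left side is at most (∑ r_x)(∑ c_y).
rows*columns≤total : ∀ (a : X → Y → Bool) xs ys →
  let r = λ x → count ys (a x)
      c = λ y → count xs (λ x → a x y)
      N = ∑ xs r
  in ∏ xs (λ x → r x ^ r x) * ∏ ys (λ y → c y ^ c y) ≤ N ^ N
rows*columns≤total {X} {Y} a xs ys = begin
  ∏ xs (λ x → r x ^ r x) * ∏ ys (λ y → c y ^ c y)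
    -- Row x has r_x ones, so r_x^(r_x) is a product with one factor r_x for each of them; likewise
    -- for columns. Together every 1 of the matrix contributes r_x c_y.
    ≡⟨ cong₂ _*_ (∏-cong (λ x → sym (^-∑ (r x) (λ y → ⟦ a x y ⟧) ys)) xs)
         (trans (∏-cong (λ y → sym (^-∑ (c y) (λ x → ⟦ a x y ⟧) xs)) ys)
                (sym (∏-swap (λ x y → c y ^ ⟦ a x y ⟧) xs ys))) ⟩
  ∏ xs (λ x → ∏ ys (λ y → r x ^ ⟦ a x y ⟧)) * ∏ xs (λ x → ∏ ys (λ y → c y ^ ⟦ a x y ⟧))
    ≡⟨ ∏-* _ _ xs ⟨
  ∏ xs (λ x → ∏ ys (λ y → r x ^ ⟦ a x y ⟧) * ∏ ys (λ y → c y ^ ⟦ a x y ⟧))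
    ≡⟨ ∏-cong (λ x → trans (sym (∏-* _ _ ys))
         (∏-cong (λ y → sym (^-distribʳ-* (r x) (c y) ⟦ a x y ⟧)) ys)) xs ⟩
  ∏ xs (λ x → ∏ ys (λ y → z (x , y) ^ ⟦ b (x , y) ⟧))
    ≡⟨ ∏-cartesianProductWith _,_ (λ p → z p ^ ⟦ b p ⟧) xs ys ⟨
  ∏ ps (λ p → z p ^ ⟦ b p ⟧)
    ≤⟨ ∏≤count^count b z ps ∑≤ ⟩
  count ps b ^ count ps b
    ≡⟨ cong₂ _^_ count≡ count≡ ⟩
  N ^ N ∎
  where
  open ≤-Reasoning
  ps = cartesianProduct xs ys
  r = λ x → count ys (a x)
  c = λ y → count xs (λ x → a x y)
  N = ∑ xs r
  b : X × Y → Bool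
  b (x , y) = a x y
  z : X × Y → ℕ
  z (x , y) = r x * c y
  count≡ : count ps b ≡ N
  count≡ = ∑-cartesianProductWith _,_ (λ p → ⟦ b p ⟧) xs ys
  ∑≤ : ∑ ps (λ p → ⟦ b p ⟧ * z p) ≤ count ps b * count ps b
  ∑≤ = begin
    ∑ ps (λ p → ⟦ b p ⟧ * z p)
      ≤⟨ ∑-mono (λ p → ≤-trans (*-monoˡ-≤ (z p) (⟦⟧≤1 (b p))) (≤-reflexive (*-identityˡ (z p)))) ps ⟩
    ∑ ps z
      ≡⟨ ∑-cartesianProductWith _,_ z xs ys ⟩
    ∑ xs (λ x → ∑ ys (λ y → r x * c y))
      ≡⟨ ∑-cong (λ x → ∑-*ˡ (r x) c ys) xs ⟩
    ∑ xs (λ x → r x * ∑ ys c)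
      ≡⟨ ∑-*ʳ (∑ ys c) r xs ⟩
    N * ∑ ys c
      ≡⟨ cong (N *_) (∑-swap (λ x y → ⟦ a x y ⟧) xs ys) ⟨
    N * N
      ≡⟨ cong₂ _*_ count≡ count≡ ⟨
    count ps b * count ps b ∎

-- Edge boundaries in powers of a graph

∑-zero-on : ∀ {X : Set} {f : X → ℕ} {xs} → All.All (λ x → f x ≡ 0) xs → ∑ xs f ≡ 0
∑-zero-on []       = refl
∑-zero-on (e ∷ es) = cong₂ _+_ e (∑-zero-on es)

∑-δ : ∀ {X : Set} (_≟_ : DecidableEquality X) (f : X → ℕ) {x xs} → Unique xs → x ∈ xs →
      ∑ xs (λ y → ⟦ does (x ≟ y) ⟧ * f y) ≡ f x
∑-δ _≟_ f {x} (x∉xs ∷ _) (here refl) = trans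
  (cong₂ _+_ (trans (cong (λ b → ⟦ b ⟧ * f x) (dec-true (x ≟ x) refl)) (*-identityˡ (f x)))
             (∑-zero-on (All.map (λ {y} x≢y → cong (λ b → ⟦ b ⟧ * f y) (dec-false (x ≟ y) x≢y)) x∉xs)))
  (+-identityʳ (f x))
∑-δ _≟_ f {x} {z ∷ xs} (z∉xs ∷ uniq) (there x∈xs) = trans
  (cong (λ b → ⟦ b ⟧ * f z + ∑ xs (λ y → ⟦ does (x ≟ y) ⟧ * f y))
        (dec-false (x ≟ z) (All.lookup z∉xs x∈xs ∘ sym)))
  (∑-δ _≟_ f uniq x∈xs)

count-all : ∀ {X : Set} (xs : List X) → count xs (λ _ → true) ≡ length xs
count-all xs = trans (∑-const 1 xs) (*-identityʳ (length xs))

module _ (G : Graph) where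
  open Graph G hiding (V)

  -- Sets are Boolean functions from here on, so that membership computes and product sets are
  -- conjunctions; `card≡size` and `boundary≡edges` translate from decidable predicates.
  size : (V G → Bool) → ℕ
  size = count vertices

  edges : (V G → Bool) → ℕ
  edges A = ∑ vertices λ x → ∑ vertices λ y → ⟦ A x ∧ not (A y) ∧ does (x ∼? y) ⟧

  size-cong : ∀ {A B} → (∀ x → A x ≡ B x) → size A ≡ size B
  size-cong A≗B = ∑-cong (λ x → cong ⟦_⟧ (A≗B x)) vertices

  edges-cong : ∀ {A B} → (∀ x → A x ≡ B x) → edges A ≡ edges B
  edges-cong A≗B = ∑-cong (λ x → ∑-cong (λ y →
    cong₂ (λ a b → ⟦ a ∧ not b ∧ does (x ∼? y) ⟧) (A≗B x) (A≗B y)) vertices) vertices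

  card≡size : ∀ {A : Pred (V G) 0ℓ} (A? : Decidable A) → card G A? ≡ size (does ∘ A?)
  card≡size A? = length-filter-count A? vertices

  boundary≡edges : ∀ {A : Pred (V G) 0ℓ} (A? : Decidable A) → boundary G A? ≡ edges (does ∘ A?)
  boundary≡edges A? = trans
    (length-filter-count (λ (x , y) → A? x ×-dec ¬? (A? y) ×-dec (x ∼? y)) (cartesianProduct vertices vertices))
    (∑-cartesianProductWith _,_ _ vertices vertices)

  ∑-δ-vertices : ∀ x f → ∑ vertices (λ y → ⟦ does (x ≟ y) ⟧ * f y) ≡ f x
  ∑-δ-vertices x f = ∑-δ _≟_ f unique (complete x)

  edges-none : edges (λ _ → false) ≡ 0
  edges-none = trans (∑-cong (λ _ → ∑-zero vertices) vertices) (∑-zero vertices)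

  edges-all : edges (λ _ → true) ≡ 0
  edges-all = edges-none

  size-none : size (λ _ → false) ≡ 0
  size-none = ∑-zero vertices

  size-all : size (λ _ → true) ≡ order G
  size-all = count-all vertices

  size-≤ : ∀ A → size A ≤ order G
  size-≤ A = ≤-trans (∑-mono (λ x → ⟦⟧≤1 (A x)) vertices) (≤-reflexive size-all)

  size-single : ∀ x → size (λ y → does (x ≟ y)) ≡ 1
  size-single x = trans (∑-cong (λ y → sym (*-identityʳ _)) vertices) (∑-δ-vertices x (λ _ → 1))

  degree : V G → ℕ
  degree x = count vertices (λ y → does (x ∼? y))

  -- Enlarging A by x only creates edges at x.
  edges-insert : ∀ x A → edges (λ y → does (x ≟ y) ∨ A y) ≤ edges A + degree x
  edges-insert x A = begin
    edges (λ y → does (x ≟ y) ∨ A y)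
      ≤⟨ ∑-mono (λ y → ∑-mono (λ z → bound (does (x ≟ y)) (A y) (does (x ≟ z)) (A z) (does (y ∼? z))) vertices) vertices ⟩
    ∑ vertices (λ y → ∑ vertices (λ z → ⟦ A y ∧ not (A z) ∧ does (y ∼? z) ⟧ + ⟦ does (x ≟ y) ⟧ * ⟦ does (y ∼? z) ⟧))
      ≡⟨ ∑-cong (λ y → trans (∑-+ _ _ vertices) (cong (∑ vertices (λ z → ⟦ A y ∧ not (A z) ∧ does (y ∼? z) ⟧) +_)
           (∑-*ˡ ⟦ does (x ≟ y) ⟧ _ vertices))) vertices ⟩
    ∑ vertices (λ y → ∑ vertices (λ z → ⟦ A y ∧ not (A z) ∧ does (y ∼? z) ⟧) + ⟦ does (x ≟ y) ⟧ * degree y)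
      ≡⟨ ∑-+ _ _ vertices ⟩
    edges A + ∑ vertices (λ y → ⟦ does (x ≟ y) ⟧ * degree y)
      ≡⟨ cong (edges A +_) (∑-δ-vertices x degree) ⟩
    edges A + degree x ∎
    where
    open ≤-Reasoning
    bound : ∀ p a q b e → ⟦ (p ∨ a) ∧ not (q ∨ b) ∧ e ⟧ ≤ ⟦ a ∧ not b ∧ e ⟧ + ⟦ p ⟧ * ⟦ e ⟧
    bound p     a true  b e = ≤-trans (≤-reflexive (cong ⟦_⟧ (∧-zeroʳ (p ∨ a)))) z≤n
    bound false a false b e = m≤m+n _ _
    bound true  a false b e = ≤-trans (lemma b e) (m≤n+m _ ⟦ a ∧ not b ∧ e ⟧)
      where
      lemma : ∀ b e → ⟦ not b ∧ e ⟧ ≤ 1 * ⟦ e ⟧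
      lemma true  e = z≤n
      lemma false e = ≤-reflexive (sym (*-identityˡ ⟦ e ⟧))

  edges-single : ∀ x → edges (λ y → does (x ≟ y)) ≡ degree x
  edges-single x = begin
    edges (λ y → does (x ≟ y))
      ≡⟨ ∑-cong (λ y → trans (∑-cong (λ z → ⟦∧⟧ (does (x ≟ y)) (not (does (x ≟ z)) ∧ does (y ∼? z))) vertices)
                              (∑-*ˡ ⟦ does (x ≟ y) ⟧ _ vertices)) vertices ⟩
    ∑ vertices (λ y → ⟦ does (x ≟ y) ⟧ * ∑ vertices (λ z → ⟦ not (does (x ≟ z)) ∧ does (y ∼? z) ⟧))
      ≡⟨ ∑-δ-vertices x _ ⟩
    ∑ vertices (λ z → ⟦ not (does (x ≟ z)) ∧ does (x ∼? z) ⟧)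
      ≡⟨ ∑-cong no-loop vertices ⟩
    degree x ∎
    where
    open ≡-Reasoning
    no-loop : ∀ z → ⟦ not (does (x ≟ z)) ∧ does (x ∼? z) ⟧ ≡ ⟦ does (x ∼? z) ⟧
    no-loop z with x ≟ z
    ... | yes x≡z = cong ⟦_⟧ (sym (dec-false (x ∼? z) (∼-irrefl x≡z)))
    ... | no _    = refl

-- Splitting off the first coordinate

module _ (G : Graph) (n : ℕ) where
  open Graph G hiding (V)
  private
    module Gⁿ  = Graph (G □^ n)
    module Gⁿ⁺¹ = Graph (G □^ suc n)

  adjacent-∷ : ∀ {x y u v} → (x ∷ u) Gⁿ⁺¹.∼ (y ∷ v) ⇔ ((u ≡ v × x ∼ y) ⊎ (x ≡ y × u Gⁿ.∼ v))
  adjacent-∷ {x} {y} {u} {v} = mk⇔ to from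
    where
    to : (x ∷ u) Gⁿ⁺¹.∼ (y ∷ v) → (u ≡ v × x ∼ y) ⊎ (x ≡ y × u Gⁿ.∼ v)
    to (Fin.zero  , e , eqs) = inj₁ (Pointwise-≡⇒≡ (ext (λ l → eqs (Fin.suc l) λ ())) , e)
    to (Fin.suc j , e , eqs) = inj₂ (eqs Fin.zero (λ ()) , j , e , λ l l≢j → eqs (Fin.suc l) λ { refl → l≢j refl })
    from : (u ≡ v × x ∼ y) ⊎ (x ≡ y × u Gⁿ.∼ v) → (x ∷ u) Gⁿ⁺¹.∼ (y ∷ v)
    from (inj₁ (refl , e)) = Fin.zero , e , λ { Fin.zero 0≢0 → contradiction refl 0≢0 ; (Fin.suc l) _ → refl }
    from (inj₂ (refl , j , e , eqs)) = Fin.suc j , e , λ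
      { Fin.zero _ → refl ; (Fin.suc l) l≢j → eqs l (λ { refl → l≢j refl }) }

  private
    -- The two kinds of edges exclude each other because `∼` is irreflexive, so their disjunction
    -- becomes a sum. The factor `a` carries the condition that the edge leaves the set.
    ⟦adjacent-∷⟧ : ∀ a x y u v → ⟦ a ∧ does ((x ∷ u) Gⁿ⁺¹.∼? (y ∷ v)) ⟧ ≡
      ⟦ does (u Gⁿ.≟ v) ⟧ * ⟦ a ∧ does (x ∼? y) ⟧ + ⟦ does (x ≟ y) ⟧ * ⟦ a ∧ does (u Gⁿ.∼? v) ⟧
    ⟦adjacent-∷⟧ false x y u v = sym (cong₂ _+_ (*-zeroʳ ⟦ does (u Gⁿ.≟ v) ⟧) (*-zeroʳ ⟦ does (x ≟ y) ⟧))
    ⟦adjacent-∷⟧ true  x y u v = trans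
      (cong ⟦_⟧ (does-⇔ adjacent-∷ ((x ∷ u) Gⁿ⁺¹.∼? (y ∷ v))
        ((u Gⁿ.≟ v) ×-dec (x ∼? y) ⊎-dec (x ≟ y) ×-dec (u Gⁿ.∼? v))))
      (exclusive (does (u Gⁿ.≟ v)) (does (x ≟ y)) (does (u Gⁿ.∼? v)) x∼y⇒x≢y)
      where
      x∼y⇒x≢y : does (x ∼? y) ∧ does (x ≟ y) ≡ false
      x∼y⇒x≢y with x ≟ y
      ... | yes x≡y = cong (_∧ true) (dec-false (x ∼? y) (∼-irrefl x≡y))
      ... | no _    with does (x ∼? y)
      ...   | true  = refl
      ...   | false = refl
      exclusive : ∀ p r s {q} → q ∧ r ≡ false → ⟦ p ∧ q ∨ r ∧ s ⟧ ≡ ⟦ p ⟧ * ⟦ q ⟧ + ⟦ r ⟧ * ⟦ s ⟧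
      exclusive false false s         _ = refl
      exclusive false true  s         _ = sym (*-identityˡ ⟦ s ⟧)
      exclusive true  false s {true}  _ = refl
      exclusive true  false s {false} _ = refl
      exclusive true  true  s {false} _ = sym (*-identityˡ ⟦ s ⟧)

  size-suc : ∀ A → size (G □^ suc n) A ≡ ∑ vertices (λ x → size (G □^ n) (A ∘ (x ∷_)))
  size-suc A = ∑-cartesianProductWith _∷_ _ vertices Gⁿ.vertices

  -- An edge either keeps the first coordinate (`vertical`) or changes nothing else (`horizontal`).
  -- In the sum over pairs, the indicators of x ≡ y and u ≡ v collapse one of the inner sums.
  edges-suc : ∀ A → edges (G □^ suc n) A ≡
    ∑ vertices (λ x → edges (G □^ n) (A ∘ (x ∷_))) + ∑ Gⁿ.vertices (λ v → edges G (λ x → A (x ∷ v)))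
  edges-suc A = begin
    edges (G □^ suc n) A
      ≡⟨ ∑-cartesianProductWith _∷_ _ vertices Gⁿ.vertices ⟩
    ∑ vertices (λ x → ∑ Gⁿ.vertices λ u → ∑ Gⁿ⁺¹.vertices λ q → F (x ∷ u) q)
      ≡⟨ ∑-cong (λ x → trans (∑-cong (λ u → inner x u) Gⁿ.vertices) (∑-+ _ _ Gⁿ.vertices)) vertices ⟩
    ∑ vertices (λ x → ∑ Gⁿ.vertices (λ u → ∑ vertices λ y → horizontal x u y) + edges (G □^ n) (A ∘ (x ∷_)))
      ≡⟨ ∑-+ _ _ vertices ⟩
    ∑ vertices (λ x → ∑ Gⁿ.vertices (λ u → ∑ vertices λ y → horizontal x u y))
      + ∑ vertices (λ x → edges (G □^ n) (A ∘ (x ∷_)))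
      ≡⟨ +-comm _ (∑ vertices (λ x → edges (G □^ n) (A ∘ (x ∷_)))) ⟩
    ∑ vertices (λ x → edges (G □^ n) (A ∘ (x ∷_)))
      + ∑ vertices (λ x → ∑ Gⁿ.vertices (λ u → ∑ vertices λ y → horizontal x u y))
      ≡⟨ cong (∑ vertices (λ x → edges (G □^ n) (A ∘ (x ∷_))) +_) (∑-swap _ vertices Gⁿ.vertices) ⟩
    ∑ vertices (λ x → edges (G □^ n) (A ∘ (x ∷_))) + ∑ Gⁿ.vertices (λ v → edges G (λ x → A (x ∷ v))) ∎
    where
    open ≡-Reasoning
    F : V (G □^ suc n) → V (G □^ suc n) → ℕ
    F p q = ⟦ A p ∧ not (A q) ∧ does (p Gⁿ⁺¹.∼? q) ⟧
    horizontal : V G → V (G □^ n) → V G → ℕ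
    horizontal x u y = ⟦ A (x ∷ u) ∧ not (A (y ∷ u)) ∧ does (x ∼? y) ⟧
    vertical : V G → V (G □^ n) → V (G □^ n) → ℕ
    vertical x u v = ⟦ A (x ∷ u) ∧ not (A (x ∷ v)) ∧ does (u Gⁿ.∼? v) ⟧
    split : ∀ x u y v → F (x ∷ u) (y ∷ v) ≡
      ⟦ does (u Gⁿ.≟ v) ⟧ * ⟦ A (x ∷ u) ∧ not (A (y ∷ v)) ∧ does (x ∼? y) ⟧ +
      ⟦ does (x ≟ y) ⟧ * ⟦ A (x ∷ u) ∧ not (A (y ∷ v)) ∧ does (u Gⁿ.∼? v) ⟧
    split x u y v = trans (cong ⟦_⟧ (sym (∧-assoc a b _)))
      (trans (⟦adjacent-∷⟧ (a ∧ b) x y u v)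
        (cong₂ (λ s t → ⟦ does (u Gⁿ.≟ v) ⟧ * ⟦ s ⟧ + ⟦ does (x ≟ y) ⟧ * ⟦ t ⟧)
          (∧-assoc a b _) (∧-assoc a b _)))
      where a = A (x ∷ u); b = not (A (y ∷ v))
    inner : ∀ x u → ∑ Gⁿ⁺¹.vertices (λ q → F (x ∷ u) q) ≡
      ∑ vertices (λ y → horizontal x u y) + ∑ Gⁿ.vertices (λ v → vertical x u v)
    inner x u = begin
      ∑ Gⁿ⁺¹.vertices (λ q → F (x ∷ u) q)
        ≡⟨ ∑-cartesianProductWith _∷_ _ vertices Gⁿ.vertices ⟩
      ∑ vertices (λ y → ∑ Gⁿ.vertices λ v → F (x ∷ u) (y ∷ v))
        ≡⟨ ∑-cong (λ y → trans (∑-cong (split x u y) Gⁿ.vertices) (trans (∑-+ _ _ Gⁿ.vertices)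
             (cong₂ _+_ (∑-δ-vertices (G □^ n) u _) (∑-*ˡ ⟦ does (x ≟ y) ⟧ _ Gⁿ.vertices)))) vertices ⟩
      ∑ vertices (λ y → horizontal x u y + ⟦ does (x ≟ y) ⟧ *
        ∑ Gⁿ.vertices (λ v → ⟦ A (x ∷ u) ∧ not (A (y ∷ v)) ∧ does (u Gⁿ.∼? v) ⟧))
        ≡⟨ trans (∑-+ _ _ vertices) (cong (∑ vertices (λ y → horizontal x u y) +_) (∑-δ-vertices G x _)) ⟩
      ∑ vertices (λ y → horizontal x u y) + ∑ Gⁿ.vertices (λ v → vertical x u v) ∎

count<length⇒∃false : ∀ {X : Set} (A : X → Bool) xs → count xs A < length xs → ∃[ x ] A x ≡ false
count<length⇒∃false A (x ∷ xs) c<l with A x in eq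
... | true  = count<length⇒∃false A xs (s≤s⁻¹ c<l)
... | false = x , eq

module _ (G : Graph) where
  open Graph G hiding (V)

  private
    insert : V G → (V G → Bool) → V G → Bool
    insert x A y = does (x ≟ y) ∨ A y

  size-insert : ∀ x A → A x ≡ false → size G (insert x A) ≡ suc (size G A)
  size-insert x A Ax = trans (∑-cong disjoint vertices)
    (trans (∑-+ _ _ vertices) (cong (_+ size G A) (size-single G x)))
    where
    disjoint : ∀ y → ⟦ does (x ≟ y) ∨ A y ⟧ ≡ ⟦ does (x ≟ y) ⟧ + ⟦ A y ⟧
    disjoint y with x ≟ y
    ... | yes refl = cong (λ b → 1 + ⟦ b ⟧) (sym Ax)
    ... | no _     = refl

  -- Vertices are added one by one: one outside the set exists while there is room, and by
  -- `edges-insert` it costs at most its degree.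
  enlarge : ∀ {D} → (∀ x → degree G x ≤ D) → ∀ A j → size G A + j ≤ order G →
            ∃[ B ] size G B ≡ size G A + j × edges G B ≤ edges G A + j * D
  enlarge         deg A zero    _    = A , sym (+-identityʳ _) , ≤-reflexive (sym (+-identityʳ _))
  enlarge {D = D} deg A (suc j) room =
    let x , Ax       = count<length⇒∃false A vertices (≤-trans (s≤s (m≤m+n (size G A) j)) room′)
        size≡        = size-insert x A Ax
        B , sB , eB  = enlarge deg (insert x A) j (≤-trans (≤-reflexive (cong (_+ j) size≡)) room′)
    in B , trans sB (trans (cong (_+ j) size≡) (sym (+-suc (size G A) j))) , (begin
      edges G B                          ≤⟨ eB ⟩
      edges G (insert x A) + j * D       ≤⟨ +-monoˡ-≤ (j * D) (edges-insert G x A) ⟩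
      edges G A + degree G x + j * D     ≤⟨ +-monoˡ-≤ (j * D) (+-monoʳ-≤ (edges G A) (deg x)) ⟩
      edges G A + D + j * D              ≡⟨ +-assoc (edges G A) D (j * D) ⟩
      edges G A + suc j * D              ∎)
    where
    open ≤-Reasoning
    room′ : suc (size G A + j) ≤ order G
    room′ = subst (_≤ order G) (+-suc (size G A) j) room

-- Product sets and blocks

module _ (G : Graph) where
  open Graph G hiding (V)

  infixr 7 _⊗_
  _⊗_ : ∀ {n} → (V G → Bool) → (V (G □^ n) → Bool) → V (G □^ suc n) → Bool
  (S ⊗ A) (x ∷ v) = S x ∧ A v

  size-⊗ : ∀ {n} S (A : V (G □^ n) → Bool) → size (G □^ suc n) (S ⊗ A) ≡ size G S * size (G □^ n) A
  size-⊗ {n} S A = begin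
    size (G □^ suc n) (S ⊗ A)                    ≡⟨ size-suc G n (S ⊗ A) ⟩
    ∑ vertices (λ x → size (G □^ n) (λ v → S x ∧ A v))
      ≡⟨ ∑-cong (λ x → trans (∑-cong (λ v → ⟦∧⟧ (S x) (A v)) (Graph.vertices (G □^ n)))
                             (∑-*ˡ ⟦ S x ⟧ _ (Graph.vertices (G □^ n)))) vertices ⟩
    ∑ vertices (λ x → ⟦ S x ⟧ * size (G □^ n) A) ≡⟨ ∑-*ʳ (size (G □^ n) A) _ vertices ⟩
    size G S * size (G □^ n) A                   ∎
    where open ≡-Reasoning

  edges-⊗ : ∀ {n} S (A : V (G □^ n) → Bool) →
    edges (G □^ suc n) (S ⊗ A) ≡ size G S * edges (G □^ n) A + size (G □^ n) A * edges G S
  edges-⊗ {n} S A = trans (edges-suc G n (S ⊗ A)) (cong₂ _+_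
    (trans (∑-cong vertical vertices) (∑-*ʳ (edges (G □^ n) A) _ vertices))
    (trans (∑-cong horizontal (Graph.vertices (G □^ n))) (∑-*ʳ (edges G S) _ (Graph.vertices (G □^ n)))))
    where
    vertical : ∀ x → edges (G □^ n) (λ v → S x ∧ A v) ≡ ⟦ S x ⟧ * edges (G □^ n) A
    vertical x with S x
    ... | true  = sym (*-identityˡ _)
    ... | false = edges-none (G □^ n)
    horizontal : ∀ v → edges G (λ x → S x ∧ A v) ≡ ⟦ A v ⟧ * edges G S
    horizontal v with A v
    ... | true  = trans (edges-cong G (λ x → ∧-identityʳ (S x))) (sym (*-identityˡ _))
    ... | false = trans (edges-cong G (λ x → ∧-zeroʳ (S x))) (edges-none G)

  order-□^ : ∀ n → order (G □^ n) ≡ order G ^ n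
  order-□^ zero    = refl
  order-□^ (suc n) = begin
    order (G □^ suc n)                           ≡⟨ size-all (G □^ suc n) ⟨
    size (G □^ suc n) (λ _ → true)               ≡⟨ size-suc G n (λ _ → true) ⟩
    ∑ vertices (λ _ → size (G □^ n) (λ _ → true)) ≡⟨ ∑-const _ vertices ⟩
    order G * size (G □^ n) (λ _ → true)         ≡⟨ cong (order G *_) (trans (size-all (G □^ n)) (order-□^ n)) ⟩
    order G * order G ^ n                        ∎
    where open ≡-Reasoning

  -- By edges-single, the degrees are the boundaries of the one-point sets {x} × {v}.
  degree-□^ : ∀ {d} → (∀ x → degree G x ≡ d) → ∀ n v → degree (G □^ n) v ≡ n * d
  degree-□^ deg zero    []      = refl
  degree-□^ {d} deg (suc n) (x ∷ v) = begin
    degree (G □^ suc n) (x ∷ v)                              ≡⟨ edges-single (G □^ suc n) (x ∷ v) ⟨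
    edges (G □^ suc n) (λ p → does ((x ∷ v) Gⁿ⁺¹.≟ p))
      ≡⟨ edges-cong (G □^ suc n) {A = λ p → does ((x ∷ v) Gⁿ⁺¹.≟ p)} {S ⊗ A} (λ { (y ∷ w) → refl }) ⟩
    edges (G □^ suc n) (S ⊗ A)                               ≡⟨ edges-⊗ S A ⟩
    size G S * edges (G □^ n) A + size (G □^ n) A * edges G S
      ≡⟨ cong₂ _+_ (cong₂ _*_ (size-single G x) (trans (edges-single (G □^ n) v) (degree-□^ deg n v)))
                   (cong₂ _*_ (size-single (G □^ n) v) (trans (edges-single G x) (deg x))) ⟩
    1 * (n * d) + 1 * d
      ≡⟨ solve 2 (λ n d → con 1 :* (n :* d) :+ con 1 :* d := (con 1 :+ n) :* d) refl n d ⟩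
    suc n * d                                                ∎
    where
    open ≡-Reasoning
    open ℕ-Solver
    module Gⁿ = Graph (G □^ n)
    module Gⁿ⁺¹ = Graph (G □^ suc n)
    S = λ y → does (x ≟ y)
    A = λ w → does (v Gⁿ.≟ w)

  Block-zero : ∀ u n v → does (Block? G u n 0 v) ≡ true
  Block-zero u n v = dec-true (Block? G u n 0 v) (λ _ ())

  -- Exhibits the block as an iterated product with the factor {u}, so that `size-⊗` and `edges-⊗`
  -- compute its size and boundary by recursion.
  Block-suc : ∀ u n t p → does (Block? G u (suc n) (suc t) p) ≡ ((λ x → does (u ≟ x)) ⊗ (does ∘ Block? G u n t)) p
  Block-suc u n t (x ∷ v) = does-⇔ (mk⇔
      (λ b → sym (b Fin.zero z<s) , λ j j<t → b (Fin.suc j) (s<s j<t))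
      (λ { (u≡x , b) Fin.zero _ → sym u≡x ; (u≡x , b) (Fin.suc j) (s≤s j<t) → b j j<t }))
    (Block? G u (suc n) (suc t) (x ∷ v)) ((u ≟ x) ×-dec Block? G u n t v)

  size-Block : ∀ u {n t} → t ≤ n → size (G □^ n) (does ∘ Block? G u n t) ≡ order G ^ (n ∸ t)
  size-Block u {n} z≤n = trans (size-cong (G □^ n) (Block-zero u n)) (trans (size-all (G □^ n)) (order-□^ n))
  size-Block u {suc n} {suc t} (s≤s t≤n) = begin
    size (G □^ suc n) (does ∘ Block? G u (suc n) (suc t))
      ≡⟨ size-cong (G □^ suc n) {B = (λ x → does (u ≟ x)) ⊗ (does ∘ Block? G u n t)} (Block-suc u n t) ⟩
    size (G □^ suc n) ((λ x → does (u ≟ x)) ⊗ (does ∘ Block? G u n t))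
      ≡⟨ size-⊗ (λ x → does (u ≟ x)) (does ∘ Block? G u n t) ⟩
    size G (λ x → does (u ≟ x)) * size (G □^ n) (does ∘ Block? G u n t)
      ≡⟨ cong₂ _*_ (size-single G u) (size-Block u t≤n) ⟩
    1 * order G ^ (n ∸ t)                                 ≡⟨ *-identityˡ _ ⟩
    order G ^ (n ∸ t)                                     ∎
    where open ≡-Reasoning

  edges-Block : ∀ {d} → (∀ x → degree G x ≡ d) → ∀ u {n t} → t ≤ n →
    edges (G □^ n) (does ∘ Block? G u n t) ≡ t * d * order G ^ (n ∸ t)
  edges-Block deg u {n} z≤n = trans (edges-cong (G □^ n) (Block-zero u n)) (edges-all (G □^ n))
  edges-Block {d} deg u {suc n} {suc t} (s≤s t≤n) = begin
    edges (G □^ suc n) (does ∘ Block? G u (suc n) (suc t))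
      ≡⟨ edges-cong (G □^ suc n) {B = (λ x → does (u ≟ x)) ⊗ (does ∘ Block? G u n t)} (Block-suc u n t) ⟩
    edges (G □^ suc n) ((λ x → does (u ≟ x)) ⊗ (does ∘ Block? G u n t))
      ≡⟨ edges-⊗ (λ x → does (u ≟ x)) (does ∘ Block? G u n t) ⟩
    size G (λ x → does (u ≟ x)) * edges (G □^ n) (does ∘ Block? G u n t)
      + size (G □^ n) (does ∘ Block? G u n t) * edges G (λ x → does (u ≟ x))
      ≡⟨ cong₂ _+_ (cong₂ _*_ (size-single G u) (edges-Block deg u t≤n))
                   (cong₂ _*_ (size-Block u t≤n) (trans (edges-single G u) (deg u))) ⟩
    1 * (t * d * M) + M * d
      ≡⟨ solve 3 (λ t d M → con 1 :* (t :* d :* M) :+ M :* d := (con 1 :+ t) :* d :* M) refl t d M ⟩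
    suc t * d * M ∎
    where
    open ≡-Reasoning
    open ℕ-Solver
    M = order G ^ (n ∸ t)

-- e(A) ≥ d |A| (n - log_m |A|), exponentiated: the case n = 1 implies all others.
entropyBound-□^ : ∀ G d → (∀ S → order G ^ (d * size G S) ≤ order G ^ edges G S * (size G S ^ size G S) ^ d) →
  ∀ n A → let s = size (G □^ n) A in
  order G ^ (n * (d * s)) ≤ order G ^ edges (G □^ n) A * (s ^ s) ^ d
entropyBound-□^ G d base = go
  where
  open Graph G hiding (V)
  open ≤-Reasoning
  m = order G
  go : ∀ n A → let s = size (G □^ n) A in m ^ (n * (d * s)) ≤ m ^ edges (G □^ n) A * (s ^ s) ^ d
  go zero A = ≤-reflexive (sym (trans
      (cong (m ^ edges (G □^ 0) A *_) (trans (cong (_^ d) (s^s (A []))) (^-zeroˡ d)))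
      (trans (*-identityʳ _) (cong (m ^_) (e0 (A [])) ))))
    where
    -- The only vertex of the zeroth power is in A or not, and 0 ^ 0 = 1 makes both cases equal. The
    -- same convention makes empty lines and layers harmless throughout.
    s^s : ∀ b → (⟦ b ⟧ + 0) ^ (⟦ b ⟧ + 0) ≡ 1
    s^s true  = refl
    s^s false = refl
    e0 : ∀ b → ⟦ b ∧ not b ∧ false ⟧ + 0 + 0 ≡ 0
    e0 true  = refl
    e0 false = refl
  go (suc n) A = begin
    m ^ (suc n * (d * N))
      ≡⟨ ^-distribˡ-+-* m (d * N) (n * (d * N)) ⟩
    m ^ (d * N) * m ^ (n * (d * N))
      -- `horizontal` multiplies the case n = 1 over all lines in the first direction, `vertical`
      -- the induction hypothesis over all layers. `C` and `R` are then the two exponentiated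
      -- conditional entropies that `rows*columns≤total` merges.
      ≤⟨ *-mono-≤ horizontal vertical ⟩
    m ^ H * C ^ d * (m ^ K * R ^ d)
      ≡⟨ solve 4 (λ h c k r → h :* c :* (k :* r) := k :* h :* (r :* c)) refl (m ^ H) (C ^ d) (m ^ K) (R ^ d) ⟩
    m ^ K * m ^ H * (R ^ d * C ^ d)
      ≡⟨ cong₂ _*_ (sym (^-distribˡ-+-* m K H)) (sym (^-distribʳ-* R C d)) ⟩
    m ^ (K + H) * (R * C) ^ d
      ≤⟨ *-monoʳ-≤ (m ^ (K + H)) (^-monoˡ-≤ d (rows*columns≤total (λ x v → A (x ∷ v)) vertices vs)) ⟩
    m ^ (K + H) * (N′ ^ N′) ^ d
      ≡⟨ cong₂ (λ e s → m ^ e * (s ^ s) ^ d) (edges-suc G n A) (size-suc G n A) ⟨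
    m ^ edges (G □^ suc n) A * (N ^ N) ^ d ∎
    where
    open ℕ-Solver
    vs = Graph.vertices (G □^ n)
    N  = size (G □^ suc n) A
    r  = λ x → size (G □^ n) (λ v → A (x ∷ v))
    c  = λ v → size G (λ x → A (x ∷ v))
    N′ = ∑ vertices r
    K  = ∑ vertices (λ x → edges (G □^ n) (λ v → A (x ∷ v)))
    H  = ∑ vs (λ v → edges G (λ x → A (x ∷ v)))
    R  = ∏ vertices (λ x → r x ^ r x)
    C  = ∏ vs (λ v → c v ^ c v)
    combine : ∀ {X : Set} (xs : List X) (f e s : X → ℕ) →
      (∀ x → m ^ f x ≤ m ^ e x * (s x ^ s x) ^ d) → m ^ ∑ xs f ≤ m ^ ∑ xs e * ∏ xs (λ x → s x ^ s x) ^ d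
    combine xs f e s le = begin
      m ^ ∑ xs f                                       ≡⟨ ^-∑ m f xs ⟨
      ∏ xs (λ x → m ^ f x)                             ≤⟨ ∏-mono le xs ⟩
      ∏ xs (λ x → m ^ e x * (s x ^ s x) ^ d)           ≡⟨ ∏-* _ _ xs ⟩
      ∏ xs (λ x → m ^ e x) * ∏ xs (λ x → (s x ^ s x) ^ d) ≡⟨ cong₂ _*_ (^-∑ m e xs) (∏-^ _ d xs) ⟩
      m ^ ∑ xs e * ∏ xs (λ x → s x ^ s x) ^ d          ∎
    vertical : m ^ (n * (d * N)) ≤ m ^ K * R ^ d
    vertical = subst (λ z → m ^ z ≤ m ^ K * R ^ d)
      (trans (∑-*ˡ n _ vertices) (cong (n *_) (trans (∑-*ˡ d r vertices) (cong (d *_) (sym (size-suc G n A))))))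
      (combine vertices (λ x → n * (d * r x)) _ r (λ x → go n (λ v → A (x ∷ v))))
    horizontal : m ^ (d * N) ≤ m ^ H * C ^ d
    horizontal = subst (λ z → m ^ z ≤ m ^ H * C ^ d)
      (trans (∑-*ˡ d c vs) (cong (d *_) (trans (sym (∑-swap _ vertices vs)) (sym (size-suc G n A)))))
      (combine vs (λ v → d * c v) _ c (λ v → base (λ x → A (x ∷ v))))

-- Sets with smaller boundary than a block

^-cancelʳ-≤ : ∀ m → 1 < m → ∀ {a b} → m ^ a ≤ m ^ b → a ≤ b
^-cancelʳ-≤ m 1<m mᵃ≤mᵇ = ≮⇒≥ (λ b<a → <⇒≱ (^-monoʳ-< m 1<m b<a) mᵃ≤mᵇ)

n<m^n : ∀ m → 1 < m → ∀ n → n < m ^ n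
n<m^n m 1<m zero    = ≤-refl
n<m^n m 1<m (suc n) = ≤-<-trans (n<m^n m 1<m n) (^-monoʳ-< m 1<m (n<1+n n))

floor-log : ∀ m → 1 < m → ∀ n → 0 < n → ∃[ q ] m ^ q ≤ n × n < m ^ suc q
floor-log m 1<m (suc zero)        _ = 0 , ≤-refl , subst (1 <_) (sym (*-identityʳ m)) 1<m
floor-log m 1<m (suc n@(suc _)) _ with floor-log m 1<m n z<s
... | q , lo , hi with suc n <? m ^ suc q
...   | yes hi′ = q , m≤n⇒m≤1+n lo , hi′
...   | no ¬hi′ = suc q , ≮⇒≥ ¬hi′ , ≤-<-trans hi (^-monoʳ-< m 1<m (n<1+n (suc q)))

-- Bernoulli's inequality (1 + 1/y)^P ≥ 1 + P/y for y > 0, multiplied by y^(P+1).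
y^P*[y+P]≤[1+y]^P*y : ∀ y P → y ^ P * (y + P) ≤ suc y ^ P * y
y^P*[y+P]≤[1+y]^P*y y zero    = ≤-reflexive (cong (1 *_) (+-identityʳ y))
y^P*[y+P]≤[1+y]^P*y y (suc P) = begin
  y * y ^ P * (y + suc P)          ≤⟨ m≤m+n _ (y ^ P * P) ⟩
  y * y ^ P * (y + suc P) + y ^ P * P
    ≡⟨ solve 3 (λ y P q → y :* q :* (y :+ (con 1 :+ P)) :+ q :* P := (con 1 :+ y) :* (q :* (y :+ P))) refl y P (y ^ P) ⟩
  suc y * (y ^ P * (y + P))        ≤⟨ *-monoʳ-≤ (suc y) (y^P*[y+P]≤[1+y]^P*y y P) ⟩
  suc y * (suc y ^ P * y)          ≡⟨ *-assoc (suc y) (suc y ^ P) y ⟨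
  suc y ^ suc P * y                ∎
  where
  open ≤-Reasoning
  open ℕ-Solver

-- Since x ≥ y + 1, the choice P = m y gives (x/y)^P ≥ 1 + P/y = 1 + m. A fixed number P of factors
-- thus gains a factor m, and P s factors gain m^s.
amplify : ∀ m {y x} .{{_ : NonZero y}} → y < x → ∃[ P ] ∀ s → m ^ s * y ^ (P * s) ≤ x ^ (P * s)
amplify m {y} {x} y<x = P , λ s → begin
  m ^ s * y ^ (P * s)     ≡⟨ cong (m ^ s *_) (^-*-assoc y P s) ⟨
  m ^ s * (y ^ P) ^ s     ≡⟨ ^-distribʳ-* m (y ^ P) s ⟨
  (m * y ^ P) ^ s         ≤⟨ ^-monoˡ-≤ s one ⟩
  (x ^ P) ^ s             ≡⟨ ^-*-assoc x P s ⟩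
  x ^ (P * s)             ∎
  where
  open ≤-Reasoning
  open ℕ-Solver
  P = m * y
  one : m * y ^ P ≤ x ^ P
  one = *-cancelʳ-≤ _ _ y (begin
    m * y ^ P * y          ≡⟨ solve 3 (λ m q y → m :* q :* y := q :* (m :* y)) refl m (y ^ P) y ⟩
    y ^ P * (m * y)        ≤⟨ *-monoʳ-≤ (y ^ P) (m≤n+m (m * y) y) ⟩
    y ^ P * (y + m * y)    ≤⟨ y^P*[y+P]≤[1+y]^P*y y P ⟩
    suc y ^ P * y          ≤⟨ *-monoˡ-≤ y (^-monoˡ-≤ P y<x) ⟩
    x ^ P * y              ∎)

module _ (G : Graph) where
  open Graph G hiding (V)

  tower : ∀ p {r} → (V G → Bool) → (V (G □^ r) → Bool) → V (G □^ (p + r)) → Bool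
  tower zero    S W = W
  tower (suc p) S W = _⊗_ G S (tower p S W)

  module _ {r} (S : V G → Bool) (W : V (G □^ r) → Bool) where

    size-tower : ∀ p → size (G □^ (p + r)) (tower p S W) ≡ size G S ^ p * size (G □^ r) W
    size-tower zero    = sym (*-identityˡ _)
    size-tower (suc p) = trans (size-⊗ G S (tower p S W))
      (trans (cong (size G S *_) (size-tower p)) (sym (*-assoc (size G S) _ _)))

    -- The factor |S| on the left avoids |S|^(p - 1).
    edges-tower : ∀ p → size G S * edges (G □^ (p + r)) (tower p S W) ≡
      size G S ^ p * (size G S * edges (G □^ r) W + p * edges G S * size (G □^ r) W)
    edges-tower zero    = sym (trans (*-identityˡ _) (+-identityʳ _))
    edges-tower (suc p) = begin
      k * edges (G □^ (suc p + r)) (tower (suc p) S W)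
        ≡⟨ cong (k *_) (edges-⊗ G S (tower p S W)) ⟩
      k * (k * edges (G □^ (p + r)) (tower p S W) + size (G □^ (p + r)) (tower p S W) * e)
        ≡⟨ cong₂ (λ a b → k * (a + b * e)) (edges-tower p) (size-tower p) ⟩
      k * (k ^ p * (k * f + p * e * w) + k ^ p * w * e)
        ≡⟨ solve 6 (λ k z f p e w → k :* (z :* (k :* f :+ p :* e :* w) :+ z :* w :* e)
             := k :* z :* (k :* f :+ (con 1 :+ p) :* e :* w)) refl k (k ^ p) f p e w ⟩
      k ^ suc p * (k * f + suc p * e * w) ∎
      where
      open ≡-Reasoning
      open ℕ-Solver
      k = size G S
      e = edges G S
      w = size (G □^ r) W
      f = edges (G □^ r) W

  everything : V G → Bool
  everything _ = true

  size-pad : ∀ {r} W l → size (G □^ (l + r)) (tower l everything W) ≡ order G ^ l * size (G □^ r) W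
  size-pad {r} W l = trans (size-tower everything W l) (cong (λ m → m ^ l * size (G □^ r) W) (size-all G))

  -- A full factor has no boundary, so padding scales boundary and size alike; this carries one
  -- example over to every larger dimension.
  edges-pad : ∀ {r} W l → edges (G □^ (l + r)) (tower l everything W) ≡ order G ^ l * edges (G □^ r) W
  edges-pad     W zero    = sym (*-identityˡ _)
  edges-pad {r} W (suc l) = begin
    edges (G □^ (suc l + r)) (tower (suc l) everything W)
      ≡⟨ edges-⊗ G everything (tower l everything W) ⟩
    size G everything * edges (G □^ (l + r)) (tower l everything W) + M * edges G everything
      ≡⟨ cong₂ _+_ (cong₂ _*_ (size-all G) (edges-pad W l)) (trans (cong (M *_) (edges-all G)) (*-zeroʳ M)) ⟩
    order G * (order G ^ l * edges (G □^ r) W) + 0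
      ≡⟨ trans (+-identityʳ _) (sym (*-assoc (order G) _ _)) ⟩
    order G ^ suc l * edges (G □^ r) W ∎
    where
    open ≡-Reasoning
    M = size (G □^ (l + r)) (tower l everything W)

private
  -- The account of the construction, multiplied by k and divided by k^p, where p = P s. On the left
  -- stand the boundary of W, that of the copies of S, and the correcting points at (p + r) d edges
  -- each. The part k d P s of the last grows with s and is paid from the gain s w, as w > k d P;
  -- what remains is k r d (w + 1), and one more s covers it.
  budget : ∀ k d e t r w P s → suc (k * d * P) ≤ w → k * (r * d) * suc w < s →
    s + e * (P * s) ≤ k * (t * d) →
    k * (w * (r * d)) + P * s * e * w + k * ((P * s + r) * d) < k * (t * d) * w
  budget k d e t r w P s kdP<w slack gain = begin-strict
    k * (w * (r * d)) + P * s * e * w + k * ((P * s + r) * d)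
      ≡⟨ solve 7 (λ k d e r w P s → k :* (w :* (r :* d)) :+ P :* s :* e :* w :+ k :* ((P :* s :+ r) :* d)
           := k :* (r :* d) :* (con 1 :+ w) :+ (k :* d :* P :* s :+ e :* (P :* s) :* w)) refl k d e r w P s ⟩
    k * (r * d) * suc w + (k * d * P * s + e * (P * s) * w)
      <⟨ +-monoˡ-< _ slack ⟩
    s + (k * d * P * s + e * (P * s) * w)
      ≡⟨ solve 4 (λ x s w f → s :+ (x :* s :+ f :* w) := (con 1 :+ x) :* s :+ f :* w) refl (k * d * P) s w (e * (P * s)) ⟩
    suc (k * d * P) * s + e * (P * s) * w
      ≤⟨ +-monoˡ-≤ _ (*-monoˡ-≤ s kdP<w) ⟩
    w * s + e * (P * s) * w
      ≡⟨ solve 3 (λ w s f → w :* s :+ f :* w := (s :+ f) :* w) refl w s (e * (P * s)) ⟩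
    (s + e * (P * s)) * w
      ≤⟨ *-monoˡ-≤ w gain ⟩
    k * (t * d) * w ∎
    where
    open ≤-Reasoning
    open ℕ-Solver

-- With k = |S|: m^q ≤ k^p < m^(q+1), so S^p × W with |W| = ⌊m^(q+r)/k^p⌋ misses
-- the size m^(q+r) by fewer than k^p points; these are added arbitrarily.
smaller-boundary : ∀ G {d} → (∀ x → degree G x ≡ d) → 1 < order G → ∀ S → 0 < size G S →
  order G ^ edges G S * (size G S ^ size G S) ^ d < order G ^ (d * size G S) →
  ∃[ n₀ ] ∀ n → n₀ ≤ n → ∃[ t ] 1 ≤ t × t ≤ n ×
    Σ[ A ∈ (V (G □^ n) → Bool) ]
      size (G □^ n) A ≡ order G ^ (n ∸ t) × edges (G □^ n) A < t * d * order G ^ (n ∸ t)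
smaller-boundary G {d} deg 1<m S 0<k y<x = n₀ , λ n n₀≤n → subst Smaller (m∸n+n≡m n₀≤n) (pad (n ∸ n₀))
  where
  open ≤-Reasoning
  open ℕ-Solver
  m = order G
  k = size G S
  e = edges G S
  instance
    m≢0 : NonZero m
    m≢0 = >-nonZero (<-trans z<s 1<m)
    k≢0 : NonZero k
    k≢0 = >-nonZero 0<k
    y≢0 : NonZero (m ^ e * (k ^ k) ^ d)
    y≢0 = m*n≢0 _ _ {{m^n≢0 m e}} {{m^n≢0 (k ^ k) d {{m^n≢0 k k}}}}
  P = proj₁ (amplify m y<x)
  -- As m^q ≤ k^p < m^(q+1), the quotient w is at least m^(r-1), and m^(r-1) > k d P for this r.
  r = suc (suc (k * d * P))
  -- Exceeds k r d (w + 1) for every w ≤ m^r: the actual w depends on p and hence on s.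
  s = suc (k * (r * d) * suc (m ^ r))
  p = P * s
  instance
    k^p≢0 : NonZero (k ^ p)
    k^p≢0 = m^n≢0 k p
  log-k^p = floor-log m 1<m (k ^ p) (m^n>0 k p)
  q = proj₁ log-k^p
  n₀ = p + r
  -- The block with m^(q+r) elements in dimension p + r fixes p - q coordinates.
  t = p ∸ q

  q≤p : q ≤ p
  q≤p = ^-cancelʳ-≤ m 1<m (≤-trans (proj₁ (proj₂ log-k^p)) (^-monoˡ-≤ p (size-≤ G S)))
  t≤p : t ≤ p
  t≤p = m∸n≤m p q
  t+q≡p : t + q ≡ p
  t+q≡p = m∸n+n≡m q≤p

  -- The inequality of `amplify` compared in exponents of m, once k^p is replaced by the smaller
  -- m^q.
  gain : s + e * p ≤ k * (t * d)
  gain = +-cancelʳ-≤ (q * (k * d)) _ _ (≤-trans (^-cancelʳ-≤ m 1<m (begin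
    m ^ (s + e * p + q * (k * d))
      ≡⟨ trans (^-distribˡ-+-* m (s + e * p) _) (cong₂ _*_ (^-distribˡ-+-* m s (e * p)) (sym (^-*-assoc m q (k * d)))) ⟩
    m ^ s * m ^ (e * p) * (m ^ q) ^ (k * d)
      ≤⟨ *-monoʳ-≤ (m ^ s * m ^ (e * p)) (^-monoˡ-≤ (k * d) (proj₁ (proj₂ log-k^p))) ⟩
    m ^ s * m ^ (e * p) * (k ^ p) ^ (k * d)
      ≡⟨ cong₂ (λ a b → m ^ s * a * b) (sym (^-*-assoc m e p)) (trans (^-*-assoc k p (k * d))
           (trans (cong (k ^_) (*-comm p (k * d))) (trans (sym (^-*-assoc k (k * d) p)) (cong (_^ p) (sym (^-*-assoc k k d)))))) ⟩
    m ^ s * (m ^ e) ^ p * ((k ^ k) ^ d) ^ p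
      ≡⟨ trans (*-assoc (m ^ s) _ _) (cong (m ^ s *_) (sym (^-distribʳ-* (m ^ e) _ p))) ⟩
    m ^ s * (m ^ e * (k ^ k) ^ d) ^ p
      ≤⟨ proj₂ (amplify m y<x) s ⟩
    (m ^ (d * k)) ^ p
      ≡⟨ ^-*-assoc m (d * k) p ⟩
    m ^ (d * k * p) ∎)) (≤-reflexive (begin-equality
    d * k * p                    ≡⟨ cong (d * k *_) t+q≡p ⟨
    d * k * (t + q)              ≡⟨ solve 4 (λ d k t q → d :* k :* (t :+ q) := k :* (t :* d) :+ q :* (k :* d)) refl d k t q ⟩
    k * (t * d) + q * (k * d)    ∎)))

  1≤t : 1 ≤ t
  1≤t = n≢0⇒n>0 (λ t≡0 → contradiction
    (≤-trans gain (≤-reflexive (trans (cong (λ t → k * (t * d)) t≡0) (*-zeroʳ k)))) λ ())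

  w ρ : ℕ
  w = m ^ (q + r) / k ^ p
  ρ = m ^ (q + r) % k ^ p

  division : k ^ p * w + ρ ≡ m ^ (q + r)
  division = trans (+-comm _ ρ) (trans (cong (ρ +_) (*-comm (k ^ p) w)) (sym (m≡m%n+[m/n]*n (m ^ (q + r)) (k ^ p))))

  w≤m^r : w ≤ m ^ r
  w≤m^r = begin
    m ^ (q + r) / k ^ p       ≤⟨ /-monoˡ-≤ (k ^ p) (begin
      m ^ (q + r)               ≡⟨ ^-distribˡ-+-* m q r ⟩
      m ^ q * m ^ r             ≤⟨ *-monoˡ-≤ (m ^ r) (proj₁ (proj₂ log-k^p)) ⟩
      k ^ p * m ^ r             ≡⟨ *-comm (k ^ p) (m ^ r) ⟩
      m ^ r * k ^ p             ∎) ⟩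
    m ^ r * k ^ p / k ^ p     ≡⟨ m*n/n≡m (m ^ r) (k ^ p) ⟩
    m ^ r                     ∎

  kdP<w : suc (k * d * P) ≤ w
  kdP<w = begin
    suc (k * d * P)            ≤⟨ <⇒≤ (n<m^n m 1<m (suc (k * d * P))) ⟩
    m ^ r′                     ≡⟨ m*n/n≡m (m ^ r′) (k ^ p) ⟨
    m ^ r′ * k ^ p / k ^ p     ≤⟨ /-monoˡ-≤ (k ^ p) (begin
      m ^ r′ * k ^ p             ≤⟨ *-monoʳ-≤ (m ^ r′) (<⇒≤ (proj₂ (proj₂ log-k^p))) ⟩
      m ^ r′ * m ^ suc q         ≡⟨ ^-distribˡ-+-* m r′ (suc q) ⟨
      m ^ (r′ + suc q)           ≡⟨ cong (m ^_) (trans (+-comm r′ (suc q)) (sym (+-suc q r′))) ⟩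
      m ^ (q + r)                ∎) ⟩
    w                          ∎
    where r′ = suc (k * d * P)

  nothing : V (G □^ r) → Bool
  nothing _ = false

  -- W may be any w points: bounding its boundary by the degrees is enough, since r does not grow
  -- with s.
  enlarge-nothing : ∃[ W ] size (G □^ r) W ≡ w × edges (G □^ r) W ≤ w * (r * d)
  enlarge-nothing =
    let W , sW , eW = enlarge (G □^ r) (λ x → ≤-reflexive (degree-□^ G deg r x)) nothing w
          (≤-trans (≤-reflexive (cong (_+ w) (size-none (G □^ r)))) (≤-trans w≤m^r (≤-reflexive (sym (order-□^ G r)))))
    in W , trans sW (cong (_+ w) (size-none (G □^ r)))
         , ≤-trans eW (≤-reflexive (cong (_+ w * (r * d)) (edges-none (G □^ r))))

  W = proj₁ enlarge-nothing
  sizeW = proj₁ (proj₂ enlarge-nothing)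
  edgesW = proj₂ (proj₂ enlarge-nothing)

  core = tower G p S W

  size-core : size (G □^ n₀) core ≡ k ^ p * w
  size-core = trans (size-tower G S W p) (cong (k ^ p *_) sizeW)

  enlarge-core : ∃[ B ] size (G □^ n₀) B ≡ size (G □^ n₀) core + ρ ×
                        edges (G □^ n₀) B ≤ edges (G □^ n₀) core + ρ * (n₀ * d)
  enlarge-core = enlarge (G □^ n₀) (λ x → ≤-reflexive (degree-□^ G deg n₀ x)) core ρ (begin
    size (G □^ n₀) core + ρ  ≡⟨ trans (cong (_+ ρ) size-core) division ⟩
    m ^ (q + r)              ≤⟨ ^-monoʳ-≤ m (+-monoˡ-≤ r q≤p) ⟩
    m ^ n₀                   ≡⟨ order-□^ G n₀ ⟨
    order (G □^ n₀)          ∎)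

  B = proj₁ enlarge-core

  sizeB : size (G □^ n₀) B ≡ m ^ (q + r)
  sizeB = trans (proj₁ (proj₂ enlarge-core)) (trans (cong (_+ ρ) size-core) division)

  edgesB : edges (G □^ n₀) B < t * d * m ^ (q + r)
  edgesB = *-cancelˡ-< k _ _ (begin-strict
    k * edges (G □^ n₀) B
      ≤⟨ *-monoʳ-≤ k (proj₂ (proj₂ enlarge-core)) ⟩
    k * (edges (G □^ n₀) core + ρ * (n₀ * d))
      ≡⟨ *-distribˡ-+ k _ _ ⟩
    k * edges (G □^ n₀) core + k * (ρ * (n₀ * d))
      ≡⟨ cong (_+ k * (ρ * (n₀ * d))) (edges-tower G S W p) ⟩
    k ^ p * (k * edges (G □^ r) W + p * e * size (G □^ r) W) + k * (ρ * (n₀ * d))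
      ≤⟨ +-mono-≤ (*-monoʳ-≤ (k ^ p) (+-mono-≤ (*-monoʳ-≤ k edgesW) (≤-reflexive (cong (p * e *_) sizeW))))
                  (*-monoʳ-≤ k (*-monoˡ-≤ (n₀ * d) (<⇒≤ (m%n<n (m ^ (q + r)) (k ^ p))))) ⟩
    k ^ p * (k * (w * (r * d)) + p * e * w) + k * (k ^ p * (n₀ * d))
      ≡⟨ solve 4 (λ z a k b → z :* a :+ k :* (z :* b) := z :* (a :+ k :* b)) refl (k ^ p) (k * (w * (r * d)) + p * e * w) k (n₀ * d) ⟩
    k ^ p * (k * (w * (r * d)) + p * e * w + k * (n₀ * d))
      <⟨ *-monoʳ-< (k ^ p) (budget k d e t r w P s kdP<w (s≤s (*-monoʳ-≤ (k * (r * d)) (s≤s w≤m^r))) gain) ⟩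
    k ^ p * (k * (t * d) * w)
      ≡⟨ solve 4 (λ z k a w → z :* (k :* a :* w) := k :* (a :* (z :* w))) refl (k ^ p) k (t * d) w ⟩
    k * (t * d * (k ^ p * w))
      ≤⟨ *-monoʳ-≤ k (*-monoʳ-≤ (t * d) (≤-trans (m≤m+n _ ρ) (≤-reflexive division))) ⟩
    k * (t * d * m ^ (q + r)) ∎)

  power : ∀ l → m ^ (l + n₀ ∸ t) ≡ m ^ l * m ^ (q + r)
  power l = trans (cong (m ^_) (begin-equality
    l + (p + r) ∸ t           ≡⟨ cong (λ p → l + (p + r) ∸ t) t+q≡p ⟨
    l + (t + q + r) ∸ t
      ≡⟨ cong (_∸ t) (solve 4 (λ l t q r → l :+ (t :+ q :+ r) := t :+ (l :+ (q :+ r))) refl l t q r) ⟩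
    t + (l + (q + r)) ∸ t     ≡⟨ m+n∸m≡n t _ ⟩
    l + (q + r)               ∎)) (^-distribˡ-+-* m l (q + r))

  Smaller : ℕ → Set
  Smaller n = ∃[ t ] 1 ≤ t × t ≤ n × Σ[ A ∈ (V (G □^ n) → Bool) ]
    size (G □^ n) A ≡ m ^ (n ∸ t) × edges (G □^ n) A < t * d * m ^ (n ∸ t)

  pad : ∀ l → Smaller (l + n₀)
  pad l = t , 1≤t , ≤-trans t≤p (≤-trans (m≤m+n p r) (m≤n+m n₀ l)) , tower G l (everything G) B
    , trans (size-pad G B l) (trans (cong (m ^ l *_) sizeB) (sym (power l)))
    , (begin-strict
        edges (G □^ (l + n₀)) (tower G l (everything G) B)  ≡⟨ edges-pad G B l ⟩
        m ^ l * edges (G □^ n₀) B                           <⟨ *-monoʳ-< (m ^ l) {{m^n≢0 m l}} edgesB ⟩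
        m ^ l * (t * d * m ^ (q + r))
          ≡⟨ solve 3 (λ a b c → a :* (b :* c) := b :* (a :* c)) refl (m ^ l) (t * d) (m ^ (q + r)) ⟩
        t * d * (m ^ l * m ^ (q + r))                       ≡⟨ cong (t * d *_) (power l) ⟨
        t * d * m ^ (l + n₀ ∸ t)                            ∎)

-- Attaining i_k(G)

foldr-⊓-∈ : ∀ q qs → foldr ℚ._⊓_ q qs ∈ q ∷ qs
foldr-⊓-∈ q []       = here refl
foldr-⊓-∈ q (p ∷ qs) with ℚₚ.⊓-sel p (foldr ℚ._⊓_ q qs)
... | inj₁ e = there (here e)
... | inj₂ e with foldr-⊓-∈ q qs
...   | here e′  = here (trans e e′)
...   | there i  = there (there (subst (_∈ qs) (sym e) i))

foldr-⊓-≤ : ∀ q qs {p} → p ∈ q ∷ qs → foldr ℚ._⊓_ q qs ℚ.≤ p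
foldr-⊓-≤ q []       (here refl)         = ℚₚ.≤-refl
foldr-⊓-≤ q (r ∷ qs) (here refl)         = ℚₚ.≤-trans (ℚₚ.p⊓q≤q r _) (foldr-⊓-≤ q qs (here refl))
foldr-⊓-≤ q (r ∷ qs) (there (here refl)) = ℚₚ.p⊓q≤p r _
foldr-⊓-≤ q (r ∷ qs) (there (there i))   = ℚₚ.≤-trans (ℚₚ.p⊓q≤q r _) (foldr-⊓-≤ q qs (there i))

minimum-∈ : ∀ {q qs} → q ∈ qs → minimum qs ∈ qs
minimum-∈ {qs = q ∷ qs} _ = foldr-⊓-∈ q qs

minimum-≤ : ∀ {q qs} → q ∈ qs → minimum qs ℚ.≤ q
minimum-≤ {qs = q ∷ qs} = foldr-⊓-≤ q qs

module _ {X : Set} where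

  combinations-nonempty : ∀ k (xs : List X) → k ≤ length xs → ∃[ A ] A ∈ combinations k xs
  combinations-nonempty zero    xs       _         = [] , here refl
  combinations-nonempty (suc k) (x ∷ xs) (s≤s k≤n) =
    let A , A∈ = combinations-nonempty k xs k≤n in x ∷ A , ∈-++⁺ˡ (∈-map⁺ (x ∷_) A∈)

  filterᵇ-∈-combinations : ∀ (S : X → Bool) xs → filterᵇ S xs ∈ combinations (length (filterᵇ S xs)) xs
  filterᵇ-∈-combinations S []       = here refl
  filterᵇ-∈-combinations S (x ∷ xs) with S x | filterᵇ-∈-combinations S xs
  ... | true  | i = ∈-++⁺ˡ (∈-map⁺ (x ∷_) i)
  ... | false | i = skip (length (filterᵇ S xs)) i
    where
    -- `combinations` does not reduce on a nonempty list until its first argument is known, hence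
    -- the case split.
    skip : ∀ k {A} → A ∈ combinations k xs → A ∈ combinations k (x ∷ xs)
    skip zero    i = i
    skip (suc k) i = ∈-++⁺ʳ (map (x ∷_) (combinations k xs)) i

  combinations-length : ∀ k (xs : List X) {A} → A ∈ combinations k xs → length A ≡ k
  combinations-length zero    xs       (here refl) = refl
  combinations-length (suc k) (x ∷ xs) i with ∈-++⁻ (map (x ∷_) (combinations k xs)) i
  ... | inj₁ j with ∈-map⁻ (x ∷_) j
  ...   | B , B∈ , refl = cong suc (combinations-length k xs B∈)
  combinations-length (suc k) (x ∷ xs) i | inj₂ j = combinations-length (suc k) xs j

  combinations-All : ∀ {P : X → Set} k xs {A} → All.All P xs → A ∈ combinations k xs → All.All P A
  combinations-All zero    xs       ps       (here refl) = []
  combinations-All (suc k) (x ∷ xs) (p ∷ ps) i with ∈-++⁻ (map (x ∷_) (combinations k xs)) i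
  ... | inj₁ j with ∈-map⁻ (x ∷_) j
  ...   | B , B∈ , refl = p ∷ combinations-All k xs ps B∈
  combinations-All (suc k) (x ∷ xs) (p ∷ ps) i | inj₂ j = combinations-All (suc k) xs ps j

  combinations-Unique : ∀ k (xs : List X) {A} → Unique xs → A ∈ combinations k xs → Unique A
  combinations-Unique zero    xs       u       (here refl) = []
  combinations-Unique (suc k) (x ∷ xs) (p ∷ u) i with ∈-++⁻ (map (x ∷_) (combinations k xs)) i
  ... | inj₁ j with ∈-map⁻ (x ∷_) j
  ...   | B , B∈ , refl = combinations-All k xs p B∈ ∷ combinations-Unique k xs u B∈
  combinations-Unique (suc k) (x ∷ xs) (p ∷ u) i | inj₂ j = combinations-Unique (suc k) xs u j

module _ (G : Graph) where
  open Graph G hiding (V)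
  open DecMembership _≟_ using (_∈?_)

  size-members : ∀ {A} → Unique A → size G (λ v → does (v ∈? A)) ≡ length A
  size-members []                      = size-none G
  size-members {x ∷ A} (x∉A ∷ unique) = begin
    size G (λ v → does (v ∈? (x ∷ A)))
      ≡⟨ size-cong G (λ v → cong (_∨ does (v ∈? A)) (does-⇔ (mk⇔ sym sym) (v ≟ x) (x ≟ v))) ⟩
    size G (λ v → does (x ≟ v) ∨ does (v ∈? A))
      ≡⟨ size-insert G x (λ v → does (v ∈? A)) (dec-false (x ∈? A) (λ x∈A → All.lookup x∉A x∈A refl)) ⟩
    suc (size G (λ v → does (v ∈? A)))
      ≡⟨ cong suc (size-members unique) ⟩
    suc (length A) ∎
    where open ≡-Reasoning

  isoperimetric-≤ : ∀ S k .{{_ : NonZero k}} → size G S ≡ k → isoperimetric G k ℚ.≤ ℤ.+ edges G S ℚ./ k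
  isoperimetric-≤ S k size≡k = subst (isoperimetric G k ℚ.≤_)
    (cong (λ e → ℤ.+ e ℚ./ k) (trans (boundary≡edges G (_∈? A)) (edges-cong G membership)))
    (minimum-≤ (∈-map⁺ _ (subst (λ j → A ∈ combinations j vertices)
      (trans (length-filter-count (T? ∘ S) vertices) size≡k) (filterᵇ-∈-combinations S vertices))))
    where
    A = filterᵇ S vertices
    membership : ∀ v → does (v ∈? A) ≡ S v
    membership v = does-⇔ (mk⇔ (proj₂ ∘ ∈-filter⁻ (T? ∘ S) {xs = vertices}) (∈-filter⁺ (T? ∘ S) (complete v))) (v ∈? A) (T? (S v))

  private
    ratio : (k : ℕ) → .{{NonZero k}} → List (V G) → ℚ
    ratio k A = ℤ.+ boundary G (λ v → v ∈? A) ℚ./ k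

  isoperimetric-attained : ∀ k .{{_ : NonZero k}} → k ≤ order G →
    ∃[ S ] size G S ≡ k × isoperimetric G k ≡ ℤ.+ edges G S ℚ./ k
  isoperimetric-attained k k≤m =
    let A₀ , A₀∈       = combinations-nonempty k vertices k≤m
        A , A∈ , min≡  = ∈-map⁻ (ratio k) (minimum-∈ (∈-map⁺ (ratio k) A₀∈))
    in (λ v → does (v ∈? A))
     , trans (size-members (combinations-Unique k vertices unique A∈)) (combinations-length k vertices A∈)
     , trans min≡ (cong (λ e → ℤ.+ e ℚ./ k) (boundary≡edges G (_∈? A)))

-- Approximating logarithms

/-≡-* : ∀ e k → ℤ.+ e ℚ./ suc k ≡ ι e ℚ.* h k
/-≡-* e k = ℚₚ.toℚᵘ-injective (begin-equality
  ℚ.toℚᵘ (ℤ.+ e ℚ./ suc k)                     ≃⟨ ℚₚ.toℚᵘ-fromℚᵘ (ℚᵘ.mkℚᵘ (ℤ.+ e) k) ⟩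
  ℚᵘ.mkℚᵘ (ℤ.+ e) k                            ≃⟨ ℚᵘ.*≡* (cong₂ ℤ._*_ (sym (ℤₚ.*-identityʳ (ℤ.+ e))) (cong (λ z → ℤ.+ suc z) (+-identityʳ k))) ⟩
  ℚᵘ.mkℚᵘ (ℤ.+ e) 0 ℚᵘ.* ℚᵘ.mkℚᵘ (ℤ.+ 1) k       ≃⟨ ℚᵘₚ.*-cong (ℚₚ.toℚᵘ-fromℚᵘ (ℚᵘ.mkℚᵘ (ℤ.+ e) 0)) (ℚₚ.toℚᵘ-fromℚᵘ (ℚᵘ.mkℚᵘ (ℤ.+ 1) k)) ⟨
  ℚ.toℚᵘ (ι e) ℚᵘ.* ℚ.toℚᵘ (h k)             ≃⟨ ℚₚ.toℚᵘ-homo-* (ι e) (h k) ⟨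
  ℚ.toℚᵘ (ι e ℚ.* h k)                       ∎)
  where open ℚᵘₚ.≤-Reasoning

ι*/ : ∀ e k .{{_ : NonZero k}} → ι k ℚ.* (ℤ.+ e ℚ./ k) ≡ ι e
ι*/ e (suc k) = begin
  ι (suc k) ℚ.* (ℤ.+ e ℚ./ suc k)     ≡⟨ cong (ι (suc k) ℚ.*_) (/-≡-* e k) ⟩
  ι (suc k) ℚ.* (ι e ℚ.* h k)       ≡⟨ solve 3 (λ k e h → k :* (e :* h) := (k :* h) :* e) refl (ι (suc k)) (ι e) (h k) ⟩
  ι (suc k) ℚ.* h k ℚ.* ι e         ≡⟨ cong (ℚ._* ι e) (ι*h k) ⟩
  1ℚ ℚ.* ι e                        ≡⟨ ℚₚ.*-identityˡ (ι e) ⟩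
  ι e                               ∎
  where
  open ≡-Reasoning
  open ℚ-Solver

0≤ι : ∀ n → 0ℚ ℚ.≤ ι n
0≤ι n = ι-mono {0} {n} z≤n

0<ι : ∀ n .{{_ : NonZero n}} → 0ℚ ℚ.< ι n
0<ι n = ℚₚ.<-≤-trans 0<1 (ι-mono {1} {n} (>-nonZero⁻¹ n))

*-mono-≤-ι : ∀ c {p q} → p ℚ.≤ q → ι c ℚ.* p ℚ.≤ ι c ℚ.* q
*-mono-≤-ι c p≤q = ℚₚ.*-monoˡ-≤-nonNeg (ι c) {{ℚ.nonNegative (0≤ι c)}} p≤q

-- The bound |x - y| ≤ δ as two one-sided inequalities, which add up without absolute values and can
-- be applied separately.
Near : ℚ → ℚ → ℚ → Set
Near δ x y = x ℚ.≤ y ℚ.+ δ × y ℚ.≤ x ℚ.+ δ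

Near-trans : ∀ {δ ε x y z} → Near δ x y → Near ε y z → Near (δ ℚ.+ ε) x z
Near-trans {δ} {ε} {x} {y} {z} (a , b) (c , d) =
  ℚₚ.≤-trans a (ℚₚ.≤-trans (ℚₚ.+-monoˡ-≤ δ c) (ℚₚ.≤-reflexive (solve 3 (λ z e d → z :+ e :+ d := z :+ (d :+ e)) refl z ε δ))) ,
  ℚₚ.≤-trans d (ℚₚ.≤-trans (ℚₚ.+-monoˡ-≤ ε b) (ℚₚ.≤-reflexive (ℚₚ.+-assoc x δ ε)))
  where open ℚ-Solver

Near-+ : ∀ {δ ε x y z w} → Near δ x y → Near ε z w → Near (δ ℚ.+ ε) (x ℚ.+ z) (y ℚ.+ w)
Near-+ {δ} {ε} {x} {y} {z} {w} (a , b) (c , d) =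
  ℚₚ.≤-trans (ℚₚ.+-mono-≤ a c) (ℚₚ.≤-reflexive (swap y δ w ε)) ,
  ℚₚ.≤-trans (ℚₚ.+-mono-≤ b d) (ℚₚ.≤-reflexive (swap x δ z ε))
  where
  open ℚ-Solver
  swap : ∀ a b c d → (a ℚ.+ b) ℚ.+ (c ℚ.+ d) ≡ (a ℚ.+ c) ℚ.+ (b ℚ.+ d)
  swap = solve 4 (λ a b c d → (a :+ b) :+ (c :+ d) := (a :+ c) :+ (b :+ d)) refl

Near-≡ : ∀ {δ δ′ x x′ y y′} → δ ≡ δ′ → x ≡ x′ → y ≡ y′ → Near δ x y → Near δ′ x′ y′
Near-≡ refl refl refl p = p

Near-refl : ∀ {x} → Near 0ℚ x x
Near-refl {x} = ℚₚ.≤-reflexive (sym (ℚₚ.+-identityʳ x)) , ℚₚ.≤-reflexive (sym (ℚₚ.+-identityʳ x))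

Near-gap : ∀ {e f x y l r ε} → Near e x l → Near f y r → 0ℚ ℚ.+ ε ℚ.≤ y ℚ.- x → e ℚ.+ f ℚ.≤ ½ ℚ.* ε →
  l ℚ.+ ½ ℚ.* ε ℚ.≤ r
Near-gap {e} {f} {x} {y} {l} {r} {ε} (_ , l≤) (y≤ , _) gap small = begin
  l ℚ.+ ½ ℚ.* ε                        ≤⟨ ℚₚ.+-monoˡ-≤ (½ ℚ.* ε) l≤ ⟩
  x ℚ.+ e ℚ.+ ½ ℚ.* ε
    ≡⟨ solve 3 (λ x e ε → x :+ e :+ con ½ :* ε := x :+ (con 0ℚ :+ ε) :+ (e :- con ½ :* ε)) refl x e ε ⟩
  x ℚ.+ (0ℚ ℚ.+ ε) ℚ.+ (e ℚ.- ½ ℚ.* ε) ≤⟨ ℚₚ.+-monoˡ-≤ (e ℚ.- ½ ℚ.* ε) (ℚₚ.+-monoʳ-≤ x gap) ⟩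
  x ℚ.+ (y ℚ.- x) ℚ.+ (e ℚ.- ½ ℚ.* ε)  ≡⟨ solve 3 (λ x y z → x :+ (y :- x) :+ z := y :+ z) refl x y (e ℚ.- ½ ℚ.* ε) ⟩
  y ℚ.+ (e ℚ.- ½ ℚ.* ε)                ≤⟨ ℚₚ.+-monoˡ-≤ (e ℚ.- ½ ℚ.* ε) y≤ ⟩
  r ℚ.+ f ℚ.+ (e ℚ.- ½ ℚ.* ε)
    ≡⟨ solve 4 (λ r f e z → r :+ f :+ (e :- z) := r :+ (e :+ f :- z)) refl r f e (½ ℚ.* ε) ⟩
  r ℚ.+ (e ℚ.+ f ℚ.- ½ ℚ.* ε)          ≤⟨ ℚₚ.+-monoʳ-≤ r (ℚₚ.+-monoˡ-≤ (ℚ.- (½ ℚ.* ε)) small) ⟩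
  r ℚ.+ (½ ℚ.* ε ℚ.- ½ ℚ.* ε)          ≡⟨ solve 2 (λ r z → r :+ (z :- z) := r) refl r (½ ℚ.* ε) ⟩
  r                                    ∎
  where
  open ℚₚ.≤-Reasoning
  open ℚ-Solver

-- The Riemann sum over [1, (a + 1) b] is cut at a + 1. Rescaling the second piece to [1, b] divides
-- the step 1/(n + 1) by a + 1, and the index n + a (n + 1) stands for exactly this finer step.
logSeq-split : ∀ a b .{{_ : NonZero b}} n →
  logSeq (suc a * b) n ≡ logSeq (suc a) n ℚ.+ logSeq b (n + a * suc n)
logSeq-split a (suc b) n = trans
  (cong (harmonic (suc n)) (solve 3 (λ a b n → (b :+ a :* (con 1 :+ b)) :* n := a :* n :+ b :* (n :+ a :* n)) refl a b (suc n)))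
  (harmonic-+ (suc n) (a * suc n) (b * (suc a * suc n)))
  where open ℕ-Solver

-- After `logSeq-split` the only error is that between log b at two step lengths, which
-- `logSeq-close` bounds by the coarser step.
logSeq-* : ∀ a b .{{_ : NonZero a}} .{{_ : NonZero b}} n →
  Near (h n) (logSeq (a * b) n) (logSeq a n ℚ.+ logSeq b n)
logSeq-* (suc a) b n = Near-≡ (ℚₚ.+-identityˡ (h n)) (sym (logSeq-split a b n)) refl
  (Near-+ (Near-refl {logSeq (suc a) n})
          (logSeq-close b n′ n , ℚₚ.≤-trans (logSeq-close b n n′)
            (ℚₚ.+-monoʳ-≤ (logSeq b n′) (h-anti (m≤m+n n (a * suc n))))))
  where n′ = n + a * suc n

logSeq-^ : ∀ a .{{_ : NonZero a}} p n → Near (ι p ℚ.* h n) (logSeq (a ^ p) n) (ι p ℚ.* logSeq a n)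
logSeq-^ a zero    n = Near-≡ (sym (ℚₚ.*-zeroˡ (h n))) refl (sym (ℚₚ.*-zeroˡ (logSeq a n))) Near-refl
logSeq-^ a (suc p) n = Near-≡ (sym (ι-suc-* p (h n))) refl (sym (ι-suc-* p (logSeq a n)))
  (Near-≡ (cong (h n ℚ.+_) (ℚₚ.+-identityˡ _)) refl refl
    (Near-trans (logSeq-* a (a ^ p) n)
                (Near-+ (Near-refl {logSeq a n}) (logSeq-^ a p n))))
  where
  instance
    a^p≢0 : NonZero (a ^ p)
    a^p≢0 = m^n≢0 a p

logSeq-^*^ : ∀ m k .{{_ : NonZero m}} .{{_ : NonZero k}} a b n →
  Near (ι (suc (a + b)) ℚ.* h n) (logSeq (m ^ a * k ^ b) n) (ι a ℚ.* logSeq m n ℚ.+ ι b ℚ.* logSeq k n)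
logSeq-^*^ m k a b n = Near-≡ error refl refl
  (Near-trans (logSeq-* (m ^ a) (k ^ b) {{m^n≢0 m a}} {{m^n≢0 k b}} n)
              (Near-+ (logSeq-^ m a n) (logSeq-^ k b n)))
  where
  open ℚ-Solver
  error : h n ℚ.+ (ι a ℚ.* h n ℚ.+ ι b ℚ.* h n) ≡ ι (suc (a + b)) ℚ.* h n
  error = trans (solve 3 (λ h a b → h :+ (a :* h :+ b :* h) := h :+ (a :+ b) :* h) refl (h n) (ι a) (ι b))
    (trans (cong (λ z → h n ℚ.+ z ℚ.* h n) (sym (ι-+ a b))) (sym (ι-suc-* (a + b) (h n))))

logSeq-mono : ∀ {a b} → a ≤ b → ∀ n → logSeq a n ℚ.≤ logSeq b n
logSeq-mono {a} {b} a≤b n = begin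
  harmonic (suc n) l                          ≡⟨ ℚₚ.+-identityʳ _ ⟨
  harmonic (suc n) l ℚ.+ 0ℚ                   ≤⟨ ℚₚ.+-monoʳ-≤ (harmonic (suc n) l) (harmonic-nonneg (suc n + l) l′) ⟩
  harmonic (suc n) l ℚ.+ harmonic (suc n + l) l′ ≡⟨ harmonic-+ (suc n) l l′ ⟨
  harmonic (suc n) (l + l′)                 ≡⟨ cong (harmonic (suc n)) (m+[n∸m]≡n (*-monoˡ-≤ (suc n) (∸-monoˡ-≤ 1 a≤b))) ⟩
  harmonic (suc n) ((b ∸ 1) * suc n)      ∎
  where
  open ℚₚ.≤-Reasoning
  l = (a ∸ 1) * suc n
  l′ = (b ∸ 1) * suc n ∸ l

0≤logSeq : ∀ k n → 0ℚ ℚ.≤ logSeq k n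
0≤logSeq k n = harmonic-nonneg (suc n) ((k ∸ 1) * suc n)

logSeq≤ι : ∀ k n → logSeq k n ℚ.≤ ι k
logSeq≤ι k n = begin
  harmonic (suc n) ((k ∸ 1) * suc n)      ≤⟨ harmonic-upper (suc n) ((k ∸ 1) * suc n) n (n≤1+n n) ⟩
  ι ((k ∸ 1) * suc n) ℚ.* h n             ≡⟨ cong (ℚ._* h n) (ι-* (k ∸ 1) (suc n)) ⟩
  ι (k ∸ 1) ℚ.* ι (suc n) ℚ.* h n           ≡⟨ trans (ℚₚ.*-assoc (ι (k ∸ 1)) (ι (suc n)) (h n))
                                                   (trans (cong (ι (k ∸ 1) ℚ.*_) (ι*h n)) (ℚₚ.*-identityʳ _)) ⟩
  ι (k ∸ 1)                                 ≤⟨ ι-mono (m∸n≤m k 1) ⟩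
  ι k                                         ∎
  where open ℚₚ.≤-Reasoning

ι*h-small : ∀ c ε → 0ℚ ℚ.< ε → ∃[ N ] ∀ n → N ≤ n → ι c ℚ.* h n ℚ.≤ ε
ι*h-small c ε 0<ε = let N , hN<ε/c = archimedean (h c ℚ.* ε) (0<p*q (h-pos c) 0<ε) in N , λ n N≤n → begin
  ι c ℚ.* h n                       ≤⟨ *-mono-≤-ι c (ℚₚ.≤-trans (h-anti N≤n) (ℚₚ.<⇒≤ hN<ε/c)) ⟩
  ι c ℚ.* (h c ℚ.* ε)               ≤⟨ ℚₚ.*-monoʳ-≤-nonNeg (h c ℚ.* ε) {{ℚ.nonNegative (ℚₚ.<⇒≤ (0<p*q (h-pos c) 0<ε))}} (ι-mono (n≤1+n c)) ⟩
  ι (suc c) ℚ.* (h c ℚ.* ε)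
    ≡⟨ trans (sym (ℚₚ.*-assoc (ι (suc c)) (h c) ε)) (trans (cong (ℚ._* ε) (ι*h c)) (ℚₚ.*-identityˡ ε)) ⟩
  ε                                 ∎
  where open ℚₚ.≤-Reasoning

module _ (m k : ℕ) .{{_ : NonZero m}} .{{_ : NonZero k}} (a b c : ℕ) where

  private
    -- C h(n) is the joint error of both sides: a + b + 1 multiples of h(n) for m^a k^b and c for
    -- m^c.
    C = suc (a + b) + c

    split-error : ∀ n → ι C ℚ.* h n ≡ ι (suc (a + b)) ℚ.* h n ℚ.+ ι c ℚ.* h n
    split-error n = trans (cong (ℚ._* h n) (ι-+ (suc (a + b)) c)) (ℚₚ.*-distribʳ-+ (h n) (ι (suc (a + b))) (ι c))

    instance
      x≢0 : NonZero (m ^ a * k ^ b)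
      x≢0 = m*n≢0 _ _ {{m^n≢0 m a}} {{m^n≢0 k b}}
      y≢0 : NonZero (m ^ c)
      y≢0 = m^n≢0 m c

  -- Distinct integers have logarithms a definite distance apart (`log-gap`), and half of it
  -- survives the errors of the product and power rules for large n.
  log-linear-< : m ^ a * k ^ b < m ^ c → ∃[ ε ] 0ℚ ℚ.< ε ×
    ∃[ N ] ∀ n → N ≤ n → ι a ℚ.* logSeq m n ℚ.+ ι b ℚ.* logSeq k n ℚ.+ ε ℚ.≤ ι c ℚ.* logSeq m n
  log-linear-< x<y =
    let ε , 0<ε , N₁ , gap = log-gap x<y
        N₂ , small         = ι*h-small C (½ ℚ.* ε) (0<p*q 0<½ 0<ε)
    in ½ ℚ.* ε , 0<p*q 0<½ 0<ε , N₁ ⊔ N₂ , λ n N≤n →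
       Near-gap {ε = ε} (logSeq-^*^ m k a b n) (logSeq-^ m c n)
         (gap n (≤-trans (m≤m⊔n N₁ N₂) N≤n))
         (subst (ℚ._≤ ½ ℚ.* ε) (split-error n) (small n (≤-trans (m≤n⊔m N₁ N₂) N≤n)))

  log-linear-≤ : m ^ c ≤ m ^ a * k ^ b → ∀ ε → 0ℚ ℚ.< ε →
    ∃[ N ] ∀ n → N ≤ n → ι c ℚ.* logSeq m n ℚ.≤ ι a ℚ.* logSeq m n ℚ.+ ι b ℚ.* logSeq k n ℚ.+ ε
  log-linear-≤ y≤x ε 0<ε = let N , small = ι*h-small C ε 0<ε in N , λ n N≤n →
    let l  = ι a ℚ.* logSeq m n ℚ.+ ι b ℚ.* logSeq k n
        e₁ = ι (suc (a + b)) ℚ.* h n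
        e₂ = ι c ℚ.* h n
    in begin
      ι c ℚ.* logSeq m n                          ≤⟨ proj₂ (logSeq-^ m c n) ⟩
      logSeq (m ^ c) n ℚ.+ e₂                   ≤⟨ ℚₚ.+-monoˡ-≤ e₂ (logSeq-mono y≤x n) ⟩
      logSeq (m ^ a * k ^ b) n ℚ.+ e₂       ≤⟨ ℚₚ.+-monoˡ-≤ e₂ (proj₁ (logSeq-^*^ m k a b n)) ⟩
      l ℚ.+ e₁ ℚ.+ e₂                             ≡⟨ trans (ℚₚ.+-assoc l e₁ e₂) (cong (l ℚ.+_) (sym (split-error n))) ⟩
      l ℚ.+ ι C ℚ.* h n                           ≤⟨ ℚₚ.+-monoʳ-≤ l (small n N≤n) ⟩
      l ℚ.+ ε                                     ∎
    where open ℚₚ.≤-Reasoning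

-- Rational inequalities for slopes and intercepts

0≤q-p⇒p≤q : ∀ {p q} → 0ℚ ℚ.≤ q ℚ.- p → p ℚ.≤ q
0≤q-p⇒p≤q {p} {q} 0≤ = ℚₚ.≤-trans (ℚₚ.≤-reflexive (sym (ℚₚ.+-identityˡ p)))
  (ℚₚ.≤-trans (ℚₚ.+-monoˡ-≤ p 0≤) (ℚₚ.≤-reflexive (solve 2 (λ p q → q :- p :+ p := q) refl p q)))
  where open ℚ-Solver

p≤q⇒0≤q-p : ∀ {p q} → p ℚ.≤ q → 0ℚ ℚ.≤ q ℚ.- p
p≤q⇒0≤q-p {p} {q} p≤q = ℚₚ.≤-trans (ℚₚ.≤-reflexive (sym (ℚₚ.+-inverseʳ p))) (ℚₚ.+-monoˡ-≤ (ℚ.- p) p≤q)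

0≤p*q : ∀ {p q} → 0ℚ ℚ.≤ p → 0ℚ ℚ.≤ q → 0ℚ ℚ.≤ p ℚ.* q
0≤p*q {p} {q} 0≤p 0≤q = ℚₚ.≤-trans (ℚₚ.≤-reflexive (sym (ℚₚ.*-zeroʳ p)))
  (ℚₚ.*-monoˡ-≤-nonNeg p {{ℚ.nonNegative 0≤p}} 0≤q)

0≤p+q : ∀ {p q} → 0ℚ ℚ.≤ p → 0ℚ ℚ.≤ q → 0ℚ ℚ.≤ p ℚ.+ q
0≤p+q = ℚₚ.+-mono-≤

∣p-q∣<ε⇒q≤p+ε : ∀ p q {ε} → ℚ.∣ p ℚ.- q ∣ ℚ.< ε → q ℚ.≤ p ℚ.+ ε
∣p-q∣<ε⇒q≤p+ε p q {ε} lt = begin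
  q                             ≡⟨ solve 2 (λ p q → q := p :+ (q :- p)) refl p q ⟩
  p ℚ.+ (q ℚ.- p)               ≤⟨ ℚₚ.+-monoʳ-≤ p (p≤∣p∣ (q ℚ.- p)) ⟩
  p ℚ.+ ℚ.∣ q ℚ.- p ∣
    ≡⟨ cong (p ℚ.+_) (trans (cong ℚ.∣_∣ (solve 2 (λ p q → q :- p := :- (p :- q)) refl p q)) (ℚₚ.∣-p∣≡∣p∣ (p ℚ.- q))) ⟩
  p ℚ.+ ℚ.∣ p ℚ.- q ∣           ≤⟨ ℚₚ.+-monoʳ-≤ p (ℚₚ.<⇒≤ lt) ⟩
  p ℚ.+ ε                       ∎
  where
  open ℚₚ.≤-Reasoning
  open ℚ-Solver
  p≤∣p∣ : ∀ p → p ℚ.≤ ℚ.∣ p ∣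
  p≤∣p∣ p with ℚₚ.≤-total 0ℚ p
  ... | inj₁ 0≤p = ℚₚ.≤-reflexive (sym (ℚₚ.0≤p⇒∣p∣≡p 0≤p))
  ... | inj₂ p≤0 = ℚₚ.≤-trans p≤0 (ℚₚ.0≤∣p∣ p)

0≰-p : ∀ {p} → 0ℚ ℚ.< p → ¬ (0ℚ ℚ.≤ ℚ.- p)
0≰-p 0<p 0≤-p = ℚₚ.<-irrefl refl (ℚₚ.≤-<-trans 0≤-p (ℚₚ.neg-antimono-< 0<p))

-- One index of the sequences: L and ℓ approximate log m and log j; r and r* the
-- inverses of log m - log j and log m - log k*; i and i* are i_j and i_{k*}.
slope-separation : ∀ {L ℓ r r* i i* e J D ε M R Q} →
  0ℚ ℚ.≤ L → 0ℚ ℚ.≤ ℓ → L ℚ.≤ M → 0ℚ ℚ.≤ r → 0ℚ ℚ.≤ J → 0ℚ ℚ.< ε → 0ℚ ℚ.< R → 0ℚ ℚ.< Q →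
  r ℚ.* (L ℚ.- ℓ) ≡ 1ℚ → R ℚ.* M ≡ 1ℚ → Q ℚ.* J ≡ 1ℚ →
  J ℚ.* i ℚ.≤ e →
  e ℚ.* L ℚ.+ D ℚ.* J ℚ.* ℓ ℚ.+ ε ℚ.≤ D ℚ.* J ℚ.* L →
  D ℚ.≤ i* ℚ.* (L ℚ.- 0ℚ) ℚ.* r* ℚ.+ ½ ℚ.* (Q ℚ.* (ε ℚ.* R)) →
  (0ℚ ℚ.- i*) ℚ.* r* ℚ.+ ½ ℚ.* (½ ℚ.* (Q ℚ.* (ε ℚ.* (R ℚ.* R)))) ℚ.≤ (0ℚ ℚ.- i) ℚ.* r
slope-separation {L} {ℓ} {r} {r*} {i} {i*} {e} {J} {D} {ε} {M} {R} {Q}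
  0≤L 0≤ℓ L≤M 0≤r 0≤J 0<ε 0<R 0<Q rg≡1 RM≡1 QJ≡1 Ji≤e gap y≈d =
  -- Were the conclusion false, J L Δ would be at least ε R / 2 by `lower` and at most ε R / 4 by
  -- `upper`.
  ℚₚ.≮⇒≥ λ far → 0≰-p 0<¼εR (subst (0ℚ ℚ.≤_)
    (solve 2 (λ x y → (x :- con ½ :* y) :+ (con ½ :* (con ½ :* y) :- x) := :- (con ½ :* (con ½ :* y))) refl (J ℚ.* L ℚ.* Δ) (ε ℚ.* R))
    (0≤p+q lower (upper far)))
  where
  open ℚ-Solver
  open ≡-Reasoning
  Δ = i* ℚ.* r* ℚ.- i ℚ.* r
  -- Chosen so that J L ε′ ≤ J M ε′ = ε R / 4.
  ε′ = ½ ℚ.* (½ ℚ.* (Q ℚ.* (ε ℚ.* (R ℚ.* R))))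

  0≤ε′ : 0ℚ ℚ.≤ ε′
  0≤ε′ = ℚₚ.<⇒≤ (0<p*q 0<½ (0<p*q 0<½ (0<p*q 0<Q (0<p*q 0<ε (0<p*q 0<R 0<R)))))

  0<¼εR : 0ℚ ℚ.< ½ ℚ.* (½ ℚ.* (ε ℚ.* R))
  0<¼εR = 0<p*q 0<½ (0<p*q 0<½ (0<p*q 0<ε 0<R))

  -- r = 1/(L - ℓ) ≥ 1/M = R, because ℓ ≥ 0 and L ≤ M; unlike r, the bound R does not vary along the
  -- sequence.
  0≤r-R : 0ℚ ℚ.≤ r ℚ.- R
  0≤r-R = subst (0ℚ ℚ.≤_) (begin
    R ℚ.* (r ℚ.* (M ℚ.- L) ℚ.+ r ℚ.* ℓ)
      ≡⟨ solve 5 (λ R r M L ℓ → R :* (r :* (M :- L) :+ r :* ℓ) := (R :* M) :* r :- R :* (r :* (L :- ℓ))) refl R r M L ℓ ⟩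
    (R ℚ.* M) ℚ.* r ℚ.- R ℚ.* (r ℚ.* (L ℚ.- ℓ))
      ≡⟨ cong₂ (λ u v → u ℚ.* r ℚ.- R ℚ.* v) RM≡1 rg≡1 ⟩
    1ℚ ℚ.* r ℚ.- R ℚ.* 1ℚ
      ≡⟨ cong₂ ℚ._-_ (ℚₚ.*-identityˡ r) (ℚₚ.*-identityʳ R) ⟩
    r ℚ.- R ∎)
    (0≤p*q (ℚₚ.<⇒≤ 0<R) (0≤p+q (0≤p*q 0≤r (p≤q⇒0≤q-p L≤M)) (0≤p*q 0≤r 0≤ℓ)))

  -- Multiplied by r = 1/(L - ℓ), `gap` reads r e L + r ε ≤ D J. Here e ≥ J i, and D exceeds i* L r*
  -- by a tolerance which J turns into ε R / 2; the other half of ε R is left.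
  lower : 0ℚ ℚ.≤ J ℚ.* L ℚ.* Δ ℚ.- ½ ℚ.* (ε ℚ.* R)
  lower = subst (0ℚ ℚ.≤_) (begin
    r ℚ.* (D ℚ.* J ℚ.* L ℚ.- (e ℚ.* L ℚ.+ D ℚ.* J ℚ.* ℓ ℚ.+ ε))
      ℚ.+ r ℚ.* L ℚ.* (e ℚ.- J ℚ.* i)
      ℚ.+ J ℚ.* (i* ℚ.* (L ℚ.- 0ℚ) ℚ.* r* ℚ.+ ½ ℚ.* (Q ℚ.* (ε ℚ.* R)) ℚ.- D)
      ℚ.+ ε ℚ.* (r ℚ.- R)
      ≡⟨ solve 12 (λ L ℓ r r* i i* e J D ε R Q →
           r :* (D :* J :* L :- (e :* L :+ D :* J :* ℓ :+ ε))
             :+ r :* L :* (e :- J :* i)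
             :+ J :* (i* :* (L :- con 0ℚ) :* r* :+ con ½ :* (Q :* (ε :* R)) :- D)
             :+ ε :* (r :- R)
           := J :* L :* (i* :* r* :- i :* r) :+ D :* J :* (r :* (L :- ℓ) :- con 1ℚ)
             :+ (con ½ :* ((Q :* J) :* (ε :* R)) :- ε :* R)) refl L ℓ r r* i i* e J D ε R Q ⟩
    J ℚ.* L ℚ.* Δ ℚ.+ D ℚ.* J ℚ.* (r ℚ.* (L ℚ.- ℓ) ℚ.- 1ℚ) ℚ.+ (½ ℚ.* ((Q ℚ.* J) ℚ.* (ε ℚ.* R)) ℚ.- ε ℚ.* R)
      ≡⟨ cong₂ (λ u v → J ℚ.* L ℚ.* Δ ℚ.+ D ℚ.* J ℚ.* (u ℚ.- 1ℚ) ℚ.+ (½ ℚ.* (v ℚ.* (ε ℚ.* R)) ℚ.- ε ℚ.* R)) rg≡1 QJ≡1 ⟩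
    J ℚ.* L ℚ.* Δ ℚ.+ D ℚ.* J ℚ.* (1ℚ ℚ.- 1ℚ) ℚ.+ (½ ℚ.* (1ℚ ℚ.* (ε ℚ.* R)) ℚ.- ε ℚ.* R)
      ≡⟨ solve 3 (λ x y z → x :+ y :* (con 1ℚ :- con 1ℚ) :+ (con ½ :* (con 1ℚ :* z) :- z) := x :- con ½ :* z)
           refl (J ℚ.* L ℚ.* Δ) (D ℚ.* J) (ε ℚ.* R) ⟩
    J ℚ.* L ℚ.* Δ ℚ.- ½ ℚ.* (ε ℚ.* R) ∎)
    (0≤p+q (0≤p+q (0≤p+q (0≤p*q 0≤r (p≤q⇒0≤q-p gap)) (0≤p*q (0≤p*q 0≤r 0≤L) (p≤q⇒0≤q-p Ji≤e)))
      (0≤p*q 0≤J (p≤q⇒0≤q-p y≈d))) (0≤p*q (ℚₚ.<⇒≤ 0<ε) 0≤r-R))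

  upper : (0ℚ ℚ.- i) ℚ.* r ℚ.< (0ℚ ℚ.- i*) ℚ.* r* ℚ.+ ε′ → 0ℚ ℚ.≤ ½ ℚ.* (½ ℚ.* (ε ℚ.* R)) ℚ.- J ℚ.* L ℚ.* Δ
  upper far = subst (0ℚ ℚ.≤_) (begin
    J ℚ.* L ℚ.* ((0ℚ ℚ.- i*) ℚ.* r* ℚ.+ ε′ ℚ.- (0ℚ ℚ.- i) ℚ.* r) ℚ.+ J ℚ.* (M ℚ.- L) ℚ.* ε′
      ≡⟨ solve 10 (λ J L M i i* r r* Q ε R →
           let ε′ = con ½ :* (con ½ :* (Q :* (ε :* (R :* R)))) in
           J :* L :* ((con 0ℚ :- i*) :* r* :+ ε′ :- (con 0ℚ :- i) :* r) :+ J :* (M :- L) :* ε′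
           := con ½ :* (con ½ :* ((Q :* J) :* (ε :* ((R :* M) :* R)))) :- J :* L :* (i* :* r* :- i :* r))
           refl J L M i i* r r* Q ε R ⟩
    ½ ℚ.* (½ ℚ.* ((Q ℚ.* J) ℚ.* (ε ℚ.* ((R ℚ.* M) ℚ.* R)))) ℚ.- J ℚ.* L ℚ.* Δ
      ≡⟨ cong₂ (λ u v → ½ ℚ.* (½ ℚ.* (u ℚ.* (ε ℚ.* (v ℚ.* R)))) ℚ.- J ℚ.* L ℚ.* Δ) QJ≡1 RM≡1 ⟩
    ½ ℚ.* (½ ℚ.* (1ℚ ℚ.* (ε ℚ.* (1ℚ ℚ.* R)))) ℚ.- J ℚ.* L ℚ.* Δ
      ≡⟨ cong (λ z → ½ ℚ.* (½ ℚ.* z) ℚ.- J ℚ.* L ℚ.* Δ)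
           (trans (ℚₚ.*-identityˡ _) (cong (ε ℚ.*_) (ℚₚ.*-identityˡ R))) ⟩
    ½ ℚ.* (½ ℚ.* (ε ℚ.* R)) ℚ.- J ℚ.* L ℚ.* Δ ∎)
    (0≤p+q (0≤p*q (0≤p*q 0≤J 0≤L) (p≤q⇒0≤q-p (ℚₚ.<⇒≤ far)))
           (0≤p*q (0≤p*q 0≤J (p≤q⇒0≤q-p L≤M)) 0≤ε′))

-- Multiplying `below` by J (L - ℓ) gives e L + J ε (L - ℓ) ≤ D J (L - ℓ), while `close` bounds the
-- right side by e L + η. The letters are those of `slope-separation`, for a single index.
intercept-separation : ∀ {L ℓ r i e J D ε δ η} → 0ℚ ℚ.≤ J → 0ℚ ℚ.≤ ε → 0ℚ ℚ.≤ δ →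
  r ℚ.* (L ℚ.- ℓ) ≡ 1ℚ → J ℚ.* i ≡ e → δ ℚ.≤ L ℚ.- ℓ →
  D ℚ.* J ℚ.* L ℚ.≤ e ℚ.* L ℚ.+ D ℚ.* J ℚ.* ℓ ℚ.+ η →
  i ℚ.* (L ℚ.- 0ℚ) ℚ.* r ℚ.+ ε ℚ.≤ D →
  J ℚ.* (ε ℚ.* δ) ℚ.≤ η
intercept-separation {L} {ℓ} {r} {i} {e} {J} {D} {ε} {δ} {η} 0≤J 0≤ε 0≤δ rg≡1 refl δ≤g close below =
  0≤q-p⇒p≤q (subst (0ℚ ℚ.≤_) (begin
    J ℚ.* (L ℚ.- ℓ) ℚ.* (D ℚ.- (i ℚ.* (L ℚ.- 0ℚ) ℚ.* r ℚ.+ ε))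
      ℚ.+ (J ℚ.* i ℚ.* L ℚ.+ D ℚ.* J ℚ.* ℓ ℚ.+ η ℚ.- D ℚ.* J ℚ.* L)
      ℚ.+ J ℚ.* ε ℚ.* (L ℚ.- ℓ ℚ.- δ)
      ≡⟨ solve 9 (λ L ℓ r i J D ε δ η →
           J :* (L :- ℓ) :* (D :- (i :* (L :- con 0ℚ) :* r :+ ε))
             :+ (J :* i :* L :+ D :* J :* ℓ :+ η :- D :* J :* L)
             :+ J :* ε :* (L :- ℓ :- δ)
           := J :* i :* L :* (con 1ℚ :- r :* (L :- ℓ)) :+ (η :- J :* (ε :* δ))) refl L ℓ r i J D ε δ η ⟩
    J ℚ.* i ℚ.* L ℚ.* (1ℚ ℚ.- r ℚ.* (L ℚ.- ℓ)) ℚ.+ (η ℚ.- J ℚ.* (ε ℚ.* δ))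
      ≡⟨ cong (λ u → J ℚ.* i ℚ.* L ℚ.* (1ℚ ℚ.- u) ℚ.+ (η ℚ.- J ℚ.* (ε ℚ.* δ))) rg≡1 ⟩
    J ℚ.* i ℚ.* L ℚ.* (1ℚ ℚ.- 1ℚ) ℚ.+ (η ℚ.- J ℚ.* (ε ℚ.* δ))
      ≡⟨ solve 2 (λ x y → x :* (con 1ℚ :- con 1ℚ) :+ y := y) refl (J ℚ.* i ℚ.* L) (η ℚ.- J ℚ.* (ε ℚ.* δ)) ⟩
    η ℚ.- J ℚ.* (ε ℚ.* δ) ∎)
    (0≤p+q (0≤p+q (0≤p*q (0≤p*q 0≤J (ℚₚ.≤-trans 0≤δ δ≤g)) (p≤q⇒0≤q-p below)) (p≤q⇒0≤q-p close))
           (0≤p*q (0≤p*q 0≤J 0≤ε) (p≤q⇒0≤q-p δ≤g))))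
  where
  open ℚ-Solver
  open ≡-Reasoning

-- The hypotheses on y_G as inequalities of powers

private
  [k^k]^d : ∀ k d → (k ^ k) ^ d ≡ k ^ (d * k)
  [k^k]^d k d = trans (^-*-assoc k k d) (cong (k ^_) (*-comm k d))

module _ (G : Graph) (d : ℕ) {k} .{{k≢0 : NonZero k}} (k<m : k < order G) where

  private
    m = order G
    instance
      m≢0 : NonZero m
      m≢0 = >-nonZero (≤-<-trans z≤n k<m)

  -- With i_k = e/k, clearing denominators in y < d gives e log m + d k log k < d k log m. The
  -- reverse inequality of powers would make the approximations violate this by at most η, for any η
  -- > 0.
  intercept<⇒power< : yIntercept G k k<m <ℝ fromℕ d → ∀ e → isoperimetric G k ≡ ℤ.+ e ℚ./ k →
    m ^ e * (k ^ k) ^ d < m ^ (d * k)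
  intercept<⇒power< (ε , 0<ε , N₁ , below) e i≡ = ≰⇒> λ y≤x →
    let δ , 0<δ , N₂ , gap = log-gap k<m
        -- Half of k ε δ, the least η that `intercept-separation` permits.
        η = ½ ℚ.* (ι k ℚ.* (ε ℚ.* δ))
        0<Kεδ = 0<p*q (0<ι k) (0<p*q 0<ε 0<δ)
        N₃ , close = log-linear-≤ m k e (d * k) (d * k) (subst (m ^ (d * k) ≤_) (cong (m ^ e *_) ([k^k]^d k d)) y≤x)
                       η (0<p*q 0<½ 0<Kεδ)
        n = N₁ ⊔ (N₂ ⊔ N₃)
        δ≤gap = subst (ℚ._≤ logSeq m n ℚ.- logSeq k n) (ℚₚ.+-identityˡ δ)
                  (gap n (≤-trans (m≤m⊔n N₂ N₃) (m≤n⊔m N₁ _)))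
        0<gap = ℚₚ.<-≤-trans 0<δ δ≤gap
    in half-smaller 0<Kεδ (intercept-separation {L = logSeq m n} {ℓ = logSeq k n} {i = isoperimetric G k}
         (0≤ι k) (ℚₚ.<⇒≤ 0<ε) (ℚₚ.<⇒≤ 0<δ) (recip-inverse 0<gap)
         (trans (cong (ι k ℚ.*_) i≡) (ι*/ e k)) δ≤gap
         (subst (λ z → z ℚ.* logSeq m n ℚ.≤ ι e ℚ.* logSeq m n ℚ.+ z ℚ.* logSeq k n ℚ.+ η) (ι-* d k)
           (close n (≤-trans (m≤n⊔m N₂ N₃) (m≤n⊔m N₁ _))))
         (below n (m≤m⊔n N₁ _)))
    where
    half-smaller : ∀ {p} → 0ℚ ℚ.< p → ¬ (p ℚ.≤ ½ ℚ.* p)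
    half-smaller {p} 0<p p≤½p = 0≰-p (0<p*q 0<½ 0<p) (subst (0ℚ ℚ.≤_)
      (solve 1 (λ p → con ½ :* p :- p := :- (con ½ :* p)) refl p) (p≤q⇒0≤q-p p≤½p))
      where open ℚ-Solver

  -- The line of k starts at height d above 0. If the inequality failed, the point (log j, i_j)
  -- would lie strictly below it, and the line of j, which also ends at (log m, 0), would have a
  -- strictly larger slope.
  optimal⇒power≤ : HasLargestSlope G k k<m → yIntercept G k k<m ≃ fromℕ d →
    ∀ j .{{_ : NonZero j}} → j < m → ∀ e → isoperimetric G j ℚ.≤ ℤ.+ e ℚ./ j →
    m ^ (d * j) ≤ m ^ e * (j ^ j) ^ d
  optimal⇒power≤ largest y≃d j j<m e i≤ = ≮⇒≥ λ x<y →
    let ε , 0<ε , N₁ , apart = log-linear-< m j e (d * j) (d * j)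
          (subst (_< m ^ (d * j)) (cong (m ^ e *_) ([k^k]^d j d)) x<y)
        δ , 0<δ , N₂ , gap = log-gap j<m
        0<M = 0<ι m
        R = recip (ι m)
        Q = recip (ι j)
        0<R = recip-pos (0<ι m)
        0<Q = recip-pos (0<ι j)
        N₃ , near = y≃d (½ ℚ.* (Q ℚ.* (ε ℚ.* R))) (0<p*q 0<½ (0<p*q 0<Q (0<p*q 0<ε 0<R)))
    in largest j j<m
      ( ½ ℚ.* (½ ℚ.* (Q ℚ.* (ε ℚ.* (R ℚ.* R))))
      , 0<p*q 0<½ (0<p*q 0<½ (0<p*q 0<Q (0<p*q 0<ε (0<p*q 0<R 0<R))))
      , N₁ ⊔ (N₂ ⊔ N₃)
      , λ n N≤n →
          let 0<gap = ℚₚ.<-≤-trans 0<δ (subst (ℚ._≤ logSeq m n ℚ.- logSeq j n) (ℚₚ.+-identityˡ δ)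
                        (gap n (≤-trans (≤-trans (m≤m⊔n N₂ N₃) (m≤n⊔m N₁ _)) N≤n)))
          in slope-separation {L = logSeq m n} {ℓ = logSeq j n} {r* = recip (logSeq m n ℚ.- logSeq k n)}
               {i = isoperimetric G j} {i* = isoperimetric G k} {e = ι e} {D = ι d}
               (0≤logSeq m n) (0≤logSeq j n) (logSeq≤ι m n) (ℚₚ.<⇒≤ (recip-pos 0<gap)) (0≤ι j) 0<ε 0<R 0<Q
               (recip-inverse 0<gap) (recip-inverse (0<ι m)) (recip-inverse (0<ι j))
               (subst (ι j ℚ.* isoperimetric G j ℚ.≤_) (ι*/ e j) (*-mono-≤-ι j i≤))
               (subst (λ z → ι e ℚ.* logSeq m n ℚ.+ z ℚ.* logSeq j n ℚ.+ ε ℚ.≤ z ℚ.* logSeq m n) (ι-* d j)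
                 (apart n (≤-trans (m≤m⊔n N₁ _) N≤n)))
               (∣p-q∣<ε⇒q≤p+ε (seq (yIntercept G k k<m) n) (ι d) (near n (≤-trans (≤-trans (m≤n⊔m N₂ N₃) (m≤n⊔m N₁ _)) N≤n)))
      )

  -- The sizes 0 and m are not covered by the slopes, but there the bound is trivial.
  power-bound : HasLargestSlope G k k<m → yIntercept G k k<m ≃ fromℕ d →
    ∀ S → m ^ (d * size G S) ≤ m ^ edges G S * (size G S ^ size G S) ^ d
  power-bound largest y≃d S = bound (size G S) refl (m≤n⇒m<n∨m≡n (size-≤ G S))
    where
    e = edges G S
    bound : ∀ j → size G S ≡ j → j < m ⊎ j ≡ m → m ^ (d * j) ≤ m ^ e * (j ^ j) ^ d
    bound zero      _     _          = subst₂ _≤_ (cong (m ^_) (sym (*-zeroʳ d)))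
      (sym (trans (cong (m ^ e *_) (^-zeroˡ d)) (*-identityʳ _))) (m^n>0 m e)
    bound j@(suc _) size≡ (inj₁ j<m) = optimal⇒power≤ largest y≃d j j<m e (isoperimetric-≤ G S j size≡)
    bound j@(suc _) _     (inj₂ j≡m) = ≤-trans
      (≤-reflexive (trans (cong (_^ (d * j)) (sym j≡m)) (sym ([k^k]^d j d))))
      (m≤n*m ((j ^ j) ^ d) (m ^ e) {{m^n≢0 m e}})

-- For |A| = m^(n-t) both sides of the entropy bound are powers of m, and comparing exponents leaves
-- e(A) ≥ t d |A|.
block-minimal : ∀ G d → 1 < order G →
  (∀ S → order G ^ (d * size G S) ≤ order G ^ edges G S * (size G S ^ size G S) ^ d) →
  ∀ {n t} → t ≤ n → ∀ A → size (G □^ n) A ≡ order G ^ (n ∸ t) →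
  t * d * order G ^ (n ∸ t) ≤ edges (G □^ n) A
block-minimal G d 1<m bound {n} {t} t≤n A size≡ = +-cancelʳ-≤ (b * (M * d)) _ _ (begin
  t * d * M + b * (M * d)
    ≡⟨ solve 4 (λ t d M b → t :* d :* M :+ b :* (M :* d) := (t :+ b) :* (d :* M)) refl t d M b ⟩
  (t + b) * (d * M)
    ≡⟨ cong (_* (d * M)) (m+[n∸m]≡n t≤n) ⟩
  n * (d * M)
    ≤⟨ ^-cancelʳ-≤ m 1<m (begin
      m ^ (n * (d * M))                            ≡⟨ cong (λ s → m ^ (n * (d * s))) size≡ ⟨
      m ^ (n * (d * size (G □^ n) A))              ≤⟨ entropyBound-□^ G d bound n A ⟩
      m ^ edges (G □^ n) A * (size (G □^ n) A ^ size (G □^ n) A) ^ d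
        ≡⟨ cong (λ s → m ^ edges (G □^ n) A * (s ^ s) ^ d) size≡ ⟩
      m ^ edges (G □^ n) A * (M ^ M) ^ d
        ≡⟨ cong (m ^ edges (G □^ n) A *_) (trans (^-*-assoc M M d) (^-*-assoc m b (M * d))) ⟩
      m ^ edges (G □^ n) A * m ^ (b * (M * d))     ≡⟨ ^-distribˡ-+-* m (edges (G □^ n) A) _ ⟨
      m ^ (edges (G □^ n) A + b * (M * d))         ∎) ⟩
  edges (G □^ n) A + b * (M * d) ∎)
  where
  open ≤-Reasoning
  open ℕ-Solver
  m = order G
  b = n ∸ t
  M = m ^ b

mainTheorem6 : (G : Graph) (d : ℕ) → 2 ≤ order G → Connected G → Regular G d → (u : V G) →
    (k* : ℕ) .{{_ : NonZero k*}} (k*<m : k* < order G) → IsOptimal G k* k*<m →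
    let y = yIntercept G k* k*<m in
    ( y ≃ fromℕ d →
    ∀ n → 1 ≤ n → ∀ t → 1 ≤ t → t ≤ n →
    {A : Pred (V (G □^ n)) 0ℓ} (A? : Decidable A) →
    card (G □^ n) A? ≡ order G ^ (n ∸ t) →
    boundary (G □^ n) (Block? G u n t) ≤ boundary (G □^ n) A? )
    ×
    ( y <ℝ fromℕ d →
    ∃[ n₀ ] (∀ n → n₀ ≤ n →
    ∃[ t ] 1 ≤ t × t ≤ n ×
    Σ[ A ∈ Pred (V (G □^ n)) 0ℓ ] Σ[ A? ∈ Decidable A ]
    card (G □^ n) A? ≡ order G ^ (n ∸ t) ×
    boundary (G □^ n) A? < boundary (G □^ n) (Block? G u n t)) )
mainTheorem6 G d 2≤m _ regular u k* k*<m optimal = minimal , not-minimal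
  where
  deg : ∀ x → degree G x ≡ d
  deg x = trans (sym (length-filter-count (Graph._∼?_ G x) (Graph.vertices G))) (regular x)

  boundary-Block : ∀ {n t} → t ≤ n → boundary (G □^ n) (Block? G u n t) ≡ t * d * order G ^ (n ∸ t)
  boundary-Block {n} {t} t≤n = trans (boundary≡edges (G □^ n) (Block? G u n t)) (edges-Block G deg u t≤n)

  minimal : yIntercept G k* k*<m ≃ fromℕ d → ∀ n → 1 ≤ n → ∀ t → 1 ≤ t → t ≤ n →
    {A : Pred (V (G □^ n)) 0ℓ} (A? : Decidable A) → card (G □^ n) A? ≡ order G ^ (n ∸ t) →
    boundary (G □^ n) (Block? G u n t) ≤ boundary (G □^ n) A?
  minimal y≃d n _ t _ t≤n A? card≡ =
    subst₂ _≤_ (sym (boundary-Block t≤n)) (sym (boundary≡edges (G □^ n) A?))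
      (block-minimal G d 2≤m (power-bound G d k*<m (IsOptimal.largest optimal) y≃d) t≤n (does ∘ A?)
        (trans (sym (card≡size (G □^ n) A?)) card≡))

  not-minimal : yIntercept G k* k*<m <ℝ fromℕ d → ∃[ n₀ ] (∀ n → n₀ ≤ n → ∃[ t ] 1 ≤ t × t ≤ n ×
    Σ[ A ∈ Pred (V (G □^ n)) 0ℓ ] Σ[ A? ∈ Decidable A ]
    card (G □^ n) A? ≡ order G ^ (n ∸ t) × boundary (G □^ n) A? < boundary (G □^ n) (Block? G u n t))
  not-minimal y<d =
    let S , size≡ , i≡ = isoperimetric-attained G k* (<⇒≤ k*<m)
        n₀ , better    = smaller-boundary G deg 2≤m S (subst (0 <_) (sym size≡) (>-nonZero⁻¹ k*))
          (subst (λ k → order G ^ edges G S * (k ^ k) ^ d < order G ^ (d * k)) (sym size≡)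
            (intercept<⇒power< G d k*<m y<d (edges G S) i≡))
    in n₀ , λ n n₀≤n →
      let t , 1≤t , t≤n , A , sizeA , edgesA = better n n₀≤n
      -- `does (T? b)` reduces to `b`, so the facts about Boolean sets apply as they stand.
      in t , 1≤t , t≤n , T ∘ A , T? ∘ A , trans (card≡size (G □^ n) (T? ∘ A)) sizeA ,
         subst₂ _<_ (sym (boundary≡edges (G □^ n) (T? ∘ A))) (sym (boundary-Block t≤n)) edgesA
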